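{- Let $\sigma$ be a list of four real numbers with $\rho(\sigma)>0$. If $\sigma$ is realizable ($\mathcal{R}$), then either $\sigma$ is irreducibly realizable ($\mathcal{IR}$), or $\sigma$ is not spectrally simple and does not have Frobenius structure.
   Context: For a list $\sigma$ of $n$ complex numbers (repeats allowed), $\rho(\sigma)$ denotes the largest absolute value of an element of $\sigma$. The list $\sigma$ is realizable ($\mathcal{R}$) if there is an $n\times n$ entrywise nonnegative matrix whose list of eigenvalues, with multiplicities, is $\sigma$ (in that case $\rho(\sigma)$ is an element of $\sigma$); it is irreducibly realizable ($\mathcal{IR}$) if such a matrix can be chosen irreducible. A square matrix is irreducible if it is not similar by a permutation matrix to a nontrivially block triangular matrix. $\sigma$ is spectrally simple if $\rho(\sigma)$ has multiplicity $1$ in $\sigma$ and is the only element of $\sigma$ of absolute value $\rho(\sigma)$. Suppose $\sigma$ is not spectrally simple but is self-conjugate, has nonnegative sum, and contains $\rho=\rho(\sigma)$. Then $\sigma$ has Frobenius structure if the elements of $\sigma$ of absolute value $\rho$ are $h>1$ in number and are exactly $\rho$ times the $h$-th roots of unity (each once), while the remaining nonzero elements lie strictly inside this circle and, counted with multiplicity, are arranged on each inner circle as a self-conjugate union of sets of $h$ equally spaced points; any number of zeros is allowed. Equivalently, the monic polynomial whose list of roots is $\sigma$ has the form $$x^p\left(x^h-\rho^h\right)\left(x^h-(z_2\rho)^h\right)\cdots\left(x^h-(z_m\rho)^h\right)$$ with $h>1$, $p\ge 0$, and nonzero complex numbers $z_j$ with $|z_j|<1$ for $j=2,\dots,m$.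 -}

module Defs where

open import Algebra.Bundles using (CommutativeRing; RawRing)
open import Algebra.Structures using (IsCommutativeRing)
open import Data.Bool.Base using (if_then_else_)
open import Data.Fin.Base using (Fin; zero; suc; toℕ; punchIn)
open import Data.Fin.Permutation using (Permutation′; _⟨$⟩ʳ_)
import Data.Fin.Properties as Fin
open import Data.List.Base using (List; foldr; map; length; filter)
import Data.List.Extrema as Extrema
import Data.List.Membership.Setoid as Membership
import Data.List.Relation.Binary.Permutation.Setoid as Permutation
open import Data.List.Relation.Unary.All using (All)
open import Data.Nat.Base as ℕ using (ℕ; zero; suc)
open import Data.Product.Base using (∃; Σ-syntax; ∃-syntax; _×_; _,_; proj₁)
open import Data.Sum.Base using (inj₁; inj₂)
open import Level using (0ℓ)
open import Relation.Binary.Bundles using (Setoid; TotalOrder)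
open import Relation.Binary.Core using (Rel)
open import Relation.Binary.Definitions using (Decidable)
open import Relation.Binary.PropositionalEquality.Core using (_≡_)
open import Relation.Binary.Structures using (IsDecTotalOrder)
import Relation.Binary.Construct.NonStrictToStrict as NonStrictToStrict
import Relation.Binary.Reasoning.PartialOrder as PartialOrderReasoning
open import Relation.Nullary using (¬_; does)
open import Relation.Nullary.Decidable using (map′; _×-dec_)

-- The real numbers, axiomatised as a Dedekind-complete ordered field (hence
-- unique up to isomorphism).  As in classical mathematics, the order is
-- decidable and every nonempty set that is bounded above has a least upper
-- bound.  Assuming excluded middle, decidable Dedekind cuts ℚ → Bool
-- are a model.

record Reals : Set₁ where
  infix  8 -_
  infixl 7 _*_
  infixl 6 _+_
  infix  4 _≈_ _≤_
  field
    ℝ   : Set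
    _≈_ : Rel ℝ 0ℓ
    _≤_ : Rel ℝ 0ℓ
    _+_ : ℝ → ℝ → ℝ
    _*_ : ℝ → ℝ → ℝ
    -_  : ℝ → ℝ
    0#  : ℝ
    1#  : ℝ

    isCommutativeRing : IsCommutativeRing _≈_ _+_ _*_ -_ 0# 1#
    0≉1               : ¬ 0# ≈ 1#
    inverse           : ∀ x → ¬ x ≈ 0# → ∃[ y ] x * y ≈ 1#

    isDecTotalOrder : IsDecTotalOrder _≈_ _≤_
    +-monoˡ-≤       : ∀ z {x y} → x ≤ y → x + z ≤ y + z
    *-nonNegative   : ∀ {x y} → 0# ≤ x → 0# ≤ y → 0# ≤ x * y

  IsUpperBound : (ℝ → Set) → ℝ → Set
  IsUpperBound S b = ∀ x → S x → x ≤ b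

  IsSupremum : (ℝ → Set) → ℝ → Set
  IsSupremum S s = IsUpperBound S s × (∀ b → IsUpperBound S b → s ≤ b)

  field
    supremum : (S : ℝ → Set) → ∃ S → ∃ (IsUpperBound S) → ∃ (IsSupremum S)

  commutativeRing : CommutativeRing 0ℓ 0ℓ
  commutativeRing = record { isCommutativeRing = isCommutativeRing }

  open NonStrictToStrict _≈_ _≤_ public using (_<_)

  module Order = IsDecTotalOrder isDecTotalOrder

  totalOrder : TotalOrder 0ℓ 0ℓ 0ℓ
  totalOrder = record { isTotalOrder = Order.isTotalOrder }

module Spectra (𝓡 : Reals) where

  open Reals 𝓡 public

  private
    module R = CommutativeRing commutativeRing
    open import Algebra.Properties.Ring R.ring
      using (-‿involutive; -‿distribˡ-*; -‿distribʳ-*)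
    open PartialOrderReasoning (TotalOrder.poset totalOrder)

    x≤0⇒0≤-x : ∀ {x} → x ≤ 0# → 0# ≤ - x
    x≤0⇒0≤-x {x} x≤0 = begin
      0#        ≈⟨ R.-‿inverseʳ x ⟨
      x + - x   ≤⟨ +-monoˡ-≤ (- x) x≤0 ⟩
      0# + - x  ≈⟨ R.+-identityˡ (- x) ⟩
      - x       ∎

    neg*neg : ∀ x → - x * - x ≈ x * x
    neg*neg x = begin-equality
      - x * - x      ≈⟨ -‿distribˡ-* x (- x) ⟨
      - (x * - x)    ≈⟨ R.-‿cong (-‿distribʳ-* x x) ⟨
      - (- (x * x))  ≈⟨ -‿involutive (x * x) ⟩
      x * x          ∎

    0≤x*x : ∀ x → 0# ≤ x * x
    0≤x*x x with Order.total 0# x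
    ... | inj₁ 0≤x = *-nonNegative 0≤x 0≤x
    ... | inj₂ x≤0 = begin
      0#         ≤⟨ *-nonNegative (x≤0⇒0≤-x x≤0) (x≤0⇒0≤-x x≤0) ⟩
      - x * - x  ≈⟨ neg*neg x ⟩
      x * x      ∎

    0≤1 : 0# ≤ 1#
    0≤1 = begin
      0#       ≤⟨ 0≤x*x 1# ⟩
      1# * 1#  ≈⟨ R.*-identityˡ 1# ⟩
      1#       ∎

    y≤x+y : ∀ {x y} → 0# ≤ x → y ≤ x + y
    y≤x+y {x} {y} 0≤x = begin
      y       ≈⟨ R.+-identityˡ y ⟨
      0# + y  ≤⟨ +-monoˡ-≤ y 0≤x ⟩
      x + y   ∎

    0≤x+y : ∀ {x y} → 0# ≤ x → 0# ≤ y → 0# ≤ x + y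
    0≤x+y 0≤x 0≤y = Order.trans 0≤y (y≤x+y 0≤x)

    1≤x⇒x≤x*x : ∀ {x} → 1# ≤ x → x ≤ x * x
    1≤x⇒x≤x*x {x} 1≤x = begin
      x                      ≤⟨ y≤x+y (*-nonNegative 0≤x-1 (Order.trans 0≤1 1≤x)) ⟩
      (x + - 1#) * x + x     ≈⟨ R.+-congˡ (R.*-identityˡ x) ⟨
      (x + - 1#) * x + 1# * x ≈⟨ R.distribʳ x (x + - 1#) 1# ⟨
      (x + - 1# + 1#) * x    ≈⟨ R.*-congʳ (R.+-assoc x (- 1#) 1#) ⟩
      (x + (- 1# + 1#)) * x  ≈⟨ R.*-congʳ (R.+-congˡ (R.-‿inverseˡ 1#)) ⟩
      (x + 0#) * x           ≈⟨ R.*-congʳ (R.+-identityʳ x) ⟩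
      x * x                  ∎
      where
      0≤x-1 : 0# ≤ x + - 1#
      0≤x-1 = begin
        0#         ≈⟨ R.-‿inverseʳ 1# ⟨
        1# + - 1#  ≤⟨ +-monoˡ-≤ (- 1#) 1≤x ⟩
        x + - 1#   ∎

    √-bound : ∀ {a} → 0# ≤ a → IsUpperBound (λ x → x * x ≤ a) (a + 1#)
    √-bound {a} 0≤a x x²≤a with Order.total x 1#
    ... | inj₁ x≤1 = Order.trans x≤1 (y≤x+y 0≤a)
    ... | inj₂ 1≤x = begin
      x       ≤⟨ 1≤x⇒x≤x*x 1≤x ⟩
      x * x   ≤⟨ x²≤a ⟩
      a       ≤⟨ y≤x+y 0≤1 ⟩
      1# + a  ≈⟨ R.+-comm 1# a ⟩
      a + 1#  ∎

    √-inhabited : ∀ {a} → 0# ≤ a → 0# * 0# ≤ a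
    √-inhabited {a} 0≤a = begin
      0# * 0#  ≈⟨ R.zeroˡ 0# ⟩
      0#       ≤⟨ 0≤a ⟩
      a        ∎

  √ : ∀ a → 0# ≤ a → ℝ
  √ a 0≤a = proj₁ (supremum (λ x → x * x ≤ a)
                            (0# , √-inhabited 0≤a) (a + 1# , √-bound 0≤a))

  record ℂ : Set where
    constructor _+i_
    field
      re : ℝ
      im : ℝ

  open ℂ public

  infix  4 _≈ᶜ_
  infix  8 -ᶜ_
  infixl 7 _*ᶜ_
  infixl 6 _+ᶜ_ _-ᶜ_

  record _≈ᶜ_ (z w : ℂ) : Set where
    constructor _,_
    field
      re≈ : re z ≈ re w
      im≈ : im z ≈ im w

  open _≈ᶜ_ public

  _+ᶜ_ : ℂ → ℂ → ℂ
  z +ᶜ w = (re z + re w) +i (im z + im w)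

  _*ᶜ_ : ℂ → ℂ → ℂ
  z *ᶜ w = (re z * re w + - (im z * im w)) +i (re z * im w + im z * re w)

  -ᶜ_ : ℂ → ℂ
  -ᶜ z = (- re z) +i (- im z)

  _-ᶜ_ : ℂ → ℂ → ℂ
  z -ᶜ w = z +ᶜ (-ᶜ w)

  ofReal : ℝ → ℂ
  ofReal x = x +i 0#

  0ᶜ : ℂ
  0ᶜ = ofReal 0#

  1ᶜ : ℂ
  1ᶜ = ofReal 1#

  ℂ-rawRing : RawRing 0ℓ 0ℓ
  ℂ-rawRing = record
    { _≈_ = _≈ᶜ_
    ; _+_ = _+ᶜ_
    ; _*_ = _*ᶜ_
    ; -_  = -ᶜ_
    ; 0#  = 0ᶜ
    ; 1#  = 1ᶜ
    }

  open import Algebra.Definitions.RawSemiring (RawRing.rawSemiring ℂ-rawRing) public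
    using (_^_) renaming (sum to ∑)

  ℂ-setoid : Setoid 0ℓ 0ℓ
  ℂ-setoid = record
    { Carrier       = ℂ
    ; _≈_           = _≈ᶜ_
    ; isEquivalence = record
      { refl  = R.refl , R.refl
      ; sym   = λ p → R.sym (re≈ p) , R.sym (im≈ p)
      ; trans = λ p q → R.trans (re≈ p) (re≈ q) , R.trans (im≈ p) (im≈ q)
      }
    }

  _≟ᶜ_ : Decidable _≈ᶜ_
  z ≟ᶜ w = map′ (λ (p , q) → p , q) (λ p → re≈ p , im≈ p)
                ((re z Order.≟ re w) ×-dec (im z Order.≟ im w))

  conj : ℂ → ℂ
  conj z = re z +i (- im z)

  ∣_∣ : ℂ → ℝ
  ∣ z ∣ = √ (re z * re z + im z * im z) (0≤x+y (0≤x*x (re z)) (0≤x*x (im z)))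

  open Membership ℂ-setoid using (_∈_)
  open Permutation ℂ-setoid using (_↭_)

  sumᶜ : List ℂ → ℂ
  sumᶜ = foldr _+ᶜ_ 0ᶜ

  productᶜ : List ℂ → ℂ
  productᶜ = foldr _*ᶜ_ 1ᶜ

  multiplicity : ℂ → List ℂ → ℕ
  multiplicity z σ = length (filter (z ≟ᶜ_) σ)

  -- The base value 0# is harmless because absolute values are nonnegative.
  ρ : List ℂ → ℝ
  ρ σ = Extrema.max totalOrder 0# (map ∣_∣ σ)

  Matrix : Set → ℕ → Set
  Matrix A n = Fin n → Fin n → A

  -- Laplace expansion along the first row.
  det : ∀ {n} → Matrix ℂ n → ℂ
  det {zero}  M = 1ᶜ
  det {suc n} M = ∑ λ j →
    (-ᶜ 1ᶜ) ^ toℕ j *ᶜ M zero j *ᶜ det (λ i k → M (suc i) (punchIn j k))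

  -- Monic polynomials over ℂ are represented by their polynomial functions,
  -- which determine them because ℂ is infinite.

  characteristicPolynomial : ∀ {n} → Matrix ℝ n → ℂ → ℂ
  characteristicPolynomial A x = det λ i j →
    (if does (i Fin.≟ j) then x else 0ᶜ) -ᶜ ofReal (A i j)

  polynomialWithRoots : List ℂ → ℂ → ℂ
  polynomialWithRoots σ x = productᶜ (map (λ z → x -ᶜ z) σ)

  -- σ lists the eigenvalues of A with their algebraic multiplicities.
  HasSpectrum : ∀ {n} → Matrix ℝ n → List ℂ → Set
  HasSpectrum A σ = ∀ x → characteristicPolynomial A x ≈ᶜ polynomialWithRoots σ x

  NonNegative : ∀ {n} → Matrix ℝ n → Set
  NonNegative A = ∀ i j → 0# ≤ A i j

  -- For the permutation matrix P of π, the (i , j) entry of P A Pᵀ is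
  -- A (π i) (π j); this matrix is block upper triangular, with square diagonal
  -- blocks of sizes k and n - k.
  Reducible : ∀ {n} → Matrix ℝ n → Set
  Reducible {n} A =
    Σ[ π ∈ Permutation′ n ] ∃[ k ] 0 ℕ.< k × k ℕ.< n ×
      (∀ i j → k ℕ.≤ toℕ i → toℕ j ℕ.< k →
        A (π ⟨$⟩ʳ i) (π ⟨$⟩ʳ j) ≈ 0#)

  Irreducible : ∀ {n} → Matrix ℝ n → Set
  Irreducible A = ¬ Reducible A

  Realizable : List ℂ → Set
  Realizable σ = ∃[ A ] NonNegative {length σ} A × HasSpectrum A σ

  IrreduciblyRealizable : List ℂ → Set
  IrreduciblyRealizable σ =
    ∃[ A ] NonNegative {length σ} A × Irreducible A × HasSpectrum A σ

  SpectrallySimple : List ℂ → Set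
  SpectrallySimple σ =
    multiplicity (ofReal (ρ σ)) σ ≡ 1 ×
    All (λ z → ∣ z ∣ ≈ ρ σ → z ≈ᶜ ofReal (ρ σ)) σ

  SelfConjugate : List ℂ → Set
  SelfConjugate σ = map conj σ ↭ σ

  NonNegativeSum : List ℂ → Set
  NonNegativeSum σ = 0# ≤ re (sumᶜ σ) × im (sumᶜ σ) ≈ 0#

  record FrobeniusStructure (σ : List ℂ) : Set where
    field
      notSpectrallySimple : ¬ SpectrallySimple σ
      selfConjugate       : SelfConjugate σ
      nonNegativeSum      : NonNegativeSum σ
      containsρ           : ofReal (ρ σ) ∈ σ

      h p : ℕ
      1<h : 1 ℕ.< h
      zs  : List ℂ
      zs≉0 : All (λ z → ¬ z ≈ᶜ 0ᶜ) zs
      zs<1 : All (λ z → ∣ z ∣ < 1#) zs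
      factorisation : ∀ x →
        polynomialWithRoots σ x ≈ᶜ
          x ^ p *ᶜ (x ^ h -ᶜ ofReal (ρ σ) ^ h)
                *ᶜ productᶜ (map (λ z → x ^ h -ᶜ (z *ᶜ ofReal (ρ σ)) ^ h) zs)

{-# OPTIONS --safe #-}
module Submission where

-- Sort σ as a ≤ b ≤ c ≤ d.  The trace of a realizing matrix gives a + b + c + d ≥ 0.
-- If c < d and d + a > 0 (this holds when σ is spectrally simple), then σ is the
-- spectrum of an irreducible nonnegative matrix that commutes with the
-- permutation (1 2)(3 4) and hence splits into two 2 × 2 blocks: when b + c < 0
-- take the multiplication table of the Klein four-group, otherwise let the
-- symmetric block carry {c, d} and the antisymmetric block {a, b}.  The Klein
-- matrix also works when c < d, a = - d and b = - c.
-- Finally, a list with Frobenius structure that is not covered by the first case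
-- is of this last form: its factorisation shows that ρ is a simple root, so
-- c < ρ and a = - ρ; as - ρ is a root, h is even, so the polynomial is even or
-- odd, which forces b + c = 0.

open import Defs
open import Algebra.Bundles using (CommutativeRing; Semiring)
import Algebra.Definitions.RawSemiring
import Algebra.Properties.AbelianGroup
import Algebra.Properties.CommutativeSemigroup
import Algebra.Properties.CommutativeSemiring.Exp as Exp
import Algebra.Properties.Monoid.Sum as Sum
import Algebra.Properties.Ring
import Algebra.Properties.Semiring.Mult as Mult
import Algebra.Properties.Semiring.Mult.TCOptimised
import Algebra.Solver.Ring
open import Algebra.Solver.Ring.AlmostCommutativeRing
  using (fromCommutativeRing; _-Raw-AlmostCommutative⟶_)
open import Algebra.Structures using (IsCommutativeRing)
open import Data.Bool.Base using (if_then_else_)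
open import Data.Empty using (⊥; ⊥-elim)
open import Data.Fin.Base using (Fin; zero; suc; toℕ; punchIn; fromℕ<; combine)
open import Data.Fin.Permutation using (_⟨$⟩ʳ_; _⟨$⟩ˡ_; inverseʳ; inverseˡ)
import Data.Fin.Properties as Fin
open import Data.Integer.Base as ℤ using (ℤ; +_; -[1+_]; _⊖_; _◃_)
import Data.Integer.Properties as ℤ
open import Data.List.Base using (List; []; _∷_; map; length; filter)
import Data.List.Extrema as Extrema
import Data.List.Membership.Setoid as Membership
open import Data.List.Properties using (filter-none; filter-accept; length-map)
open import Data.List.Relation.Binary.Permutation.Propositional as ↭ using (_↭_)
import Data.List.Relation.Binary.Permutation.Propositional.Properties as ↭
open import Data.List.Relation.Unary.All as All using (All; []; _∷_)
import Data.List.Relation.Unary.All.Properties as All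
open import Data.List.Relation.Unary.Any using (here; there)
open import Data.List.Relation.Unary.Linked using ([-]; _∷_)
import Data.List.Relation.Unary.Sorted.TotalOrder as Sorted
import Data.List.Sort as Sort
open import Data.Maybe.Base using (Maybe; just; nothing)
open import Data.Nat.Base as ℕ using (ℕ; zero; suc; z≤n; s≤s)
import Data.Nat.Properties as ℕ
open import Data.Product.Base using (∃; _×_; _,_; proj₁; proj₂)
import Data.Sign.Base as Sign
open import Data.Sum.Base as ⊎ using (_⊎_; inj₁; inj₂; [_,_]′)
open import Data.Vec.Base as Vec using (Vec; []; _∷_; lookup)
import Data.Vec.Functional as Vector
import Data.Vec.Relation.Unary.All as VecAll
open import Data.Vec.Relation.Unary.All.Properties using (lookup⁺)
open import Function.Base using (_∘_)
open import Relation.Binary.Bundles using (DecTotalOrder; Setoid)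
open import Relation.Binary.Construct.Closure.ReflexiveTransitive using (Star; ε; _◅_; _◅◅_)
open import Relation.Binary.PropositionalEquality.Core as ≡ using (_≡_)
import Relation.Binary.Reasoning.Setoid as SetoidReasoning
open import Relation.Nullary using (¬_; Dec; yes; no; does; contradiction)
open import Relation.Nullary.Decidable using (_×-dec_)
open import Relation.Unary using (Decidable)

-- Polynomials enter only as functions, so coefficients and root multiplicities have to be recovered
-- from values. A fixed combination of the values at 1, -1, 2 and -2 isolates the coefficient of x³,
-- hence the trace. Simplicity of ρ comes from growth: to the right of ρ the factorisation bounds
-- |f(t)| below by a positive multiple of t - ρ, while a double root would make f(t) of order (t -
-- ρ)² near ρ.
--
-- The Klein table alone does not suffice for the dominant lists: one of its entries is (d + a - b -
-- c)/4, which can be negative once b + c > 0. The second construction takes over for b + c ≥ 0, and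
-- it uses that inequality for an entry of its own. Both are linear in the list up to a midpoint, so
-- no square roots occur.

module IntegerCoefficients {c ℓ} (K : CommutativeRing c ℓ) where
  open CommutativeRing K
  open Algebra.Properties.Semiring.Mult.TCOptimised semiring using (1+×; ×-homo-+; ×1-homo-*)
    renaming (_×_ to _·_)
  open Algebra.Properties.Ring ring
    using (-‿involutive; -‿distribˡ-*; -‿distribʳ-*; -0#≈0#)
  open Algebra.Properties.AbelianGroup +-abelianGroup using (⁻¹-∙-comm)
  open SetoidReasoning setoid

  -- Integer coefficients give the solver a decidable equality over any commutative ring. The
  -- optimised multiple makes `fromℤ (+ 1)` compute to `1#`, so `con (+ 1)` matches a literal `1#`
  -- in a goal.
  fromℤ : ℤ → Carrier
  fromℤ (+ n)    = n · 1#
  fromℤ -[1+ n ] = - (suc n · 1#)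

  private
    cancel-1 : ∀ x y → (1# + x) + - (1# + y) ≈ x + - y
    cancel-1 x y = begin
      (1# + x) + - (1# + y)      ≈⟨ +-cong (+-comm x 1#) (⁻¹-∙-comm 1# y) ⟨
      (x + 1#) + (- 1# + - y)    ≈⟨ +-assoc x 1# _ ⟩
      x + (1# + (- 1# + - y))    ≈⟨ +-congˡ (+-assoc 1# (- 1#) (- y)) ⟨
      x + (1# + - 1# + - y)      ≈⟨ +-congˡ (+-congʳ (-‿inverseʳ 1#)) ⟩
      x + (0# + - y)             ≈⟨ +-congˡ (+-identityˡ (- y)) ⟩
      x + - y                    ∎

  fromℤ-⊖ : ∀ m n → fromℤ (m ⊖ n) ≈ m · 1# + - (n · 1#)
  fromℤ-⊖ zero    zero    = sym (-‿inverseʳ 0#)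
  fromℤ-⊖ zero    (suc n) = sym (+-identityˡ _)
  fromℤ-⊖ (suc m) zero    = sym (trans (+-congˡ -0#≈0#) (+-identityʳ _))
  fromℤ-⊖ (suc m) (suc n) = begin
    fromℤ (suc m ⊖ suc n)              ≡⟨ ≡.cong fromℤ (ℤ.[1+m]⊖[1+n]≡m⊖n m n) ⟩
    fromℤ (m ⊖ n)                      ≈⟨ fromℤ-⊖ m n ⟩
    m · 1# + - (n · 1#)                ≈⟨ cancel-1 _ _ ⟨
    (1# + m · 1#) + - (1# + n · 1#)    ≈⟨ +-cong (1+× m 1#) (-‿cong (1+× n 1#)) ⟨
    suc m · 1# + - (suc n · 1#)        ∎

  fromℤ-+ : ∀ i j → fromℤ (i ℤ.+ j) ≈ fromℤ i + fromℤ j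
  fromℤ-+ (+ m)    (+ n)    = ×-homo-+ 1# m n
  fromℤ-+ (+ m)    -[1+ n ] = fromℤ-⊖ m (suc n)
  fromℤ-+ -[1+ m ] (+ n)    = trans (fromℤ-⊖ n (suc m)) (+-comm _ _)
  fromℤ-+ -[1+ m ] -[1+ n ] = begin
    - (suc (suc (m ℕ.+ n)) · 1#)           ≡⟨ ≡.cong (λ k → - (k · 1#)) (≡.sym (ℕ.+-suc
        (suc m) n)) ⟩
    - ((suc m ℕ.+ suc n) · 1#)             ≈⟨ -‿cong (×-homo-+ 1# (suc m) (suc n)) ⟩
    - (suc m · 1# + suc n · 1#)            ≈⟨ ⁻¹-∙-comm _ _ ⟨
    - (suc m · 1#) + - (suc n · 1#)        ∎

  fromℤ-neg : ∀ i → fromℤ (ℤ.- i) ≈ - fromℤ i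
  fromℤ-neg (+ zero)  = sym -0#≈0#
  fromℤ-neg (+ suc n) = refl
  fromℤ-neg -[1+ n ]  = sym (-‿involutive _)

  fromℤ-+◃ : ∀ n → fromℤ (Sign.+ ◃ n) ≈ n · 1#
  fromℤ-+◃ zero    = refl
  fromℤ-+◃ (suc n) = refl

  fromℤ--◃ : ∀ n → fromℤ (Sign.- ◃ n) ≈ - (n · 1#)
  fromℤ--◃ zero    = sym -0#≈0#
  fromℤ--◃ (suc n) = refl

  fromℤ-* : ∀ i j → fromℤ (i ℤ.* j) ≈ fromℤ i * fromℤ j
  fromℤ-* (+ m)    (+ n)    = trans (fromℤ-+◃ (m ℕ.* n)) (×1-homo-* m n)
  fromℤ-* (+ m)    -[1+ n ] = begin
    fromℤ (Sign.- ◃ (m ℕ.* suc n))    ≈⟨ fromℤ--◃ (m ℕ.* suc n) ⟩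
    - ((m ℕ.* suc n) · 1#)            ≈⟨ -‿cong (×1-homo-* m (suc n)) ⟩
    - (m · 1# * (suc n · 1#))         ≈⟨ -‿distribʳ-* _ _ ⟩
    m · 1# * - (suc n · 1#)           ∎
  fromℤ-* -[1+ m ] (+ n)    = begin
    fromℤ (Sign.- ◃ (suc m ℕ.* n))    ≈⟨ fromℤ--◃ (suc m ℕ.* n) ⟩
    - ((suc m ℕ.* n) · 1#)            ≈⟨ -‿cong (×1-homo-* (suc m) n) ⟩
    - (suc m · 1# * (n · 1#))         ≈⟨ -‿distribˡ-* _ _ ⟩
    - (suc m · 1#) * (n · 1#)         ∎
  fromℤ-* -[1+ m ] -[1+ n ] = begin
    (suc m ℕ.* suc n) · 1#                 ≈⟨ ×1-homo-* (suc m) (suc n) ⟩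
    suc m · 1# * (suc n · 1#)              ≈⟨ -‿involutive _ ⟨
    - - (suc m · 1# * (suc n · 1#))        ≈⟨ -‿cong (-‿distribʳ-* _ _) ⟩
    - (suc m · 1# * - (suc n · 1#))        ≈⟨ -‿distribˡ-* _ _ ⟩
    - (suc m · 1#) * - (suc n · 1#)        ∎

  private
    homomorphism : ℤ.+-*-rawRing -Raw-AlmostCommutative⟶ fromCommutativeRing K
    homomorphism = record
      { ⟦_⟧    = fromℤ
      ; +-homo = fromℤ-+
      ; *-homo = fromℤ-*
      ; -‿homo = fromℤ-neg
      ; 0-homo = refl
      ; 1-homo = refl
      }

    equal? : ∀ i j → Maybe (fromℤ i ≈ fromℤ j)
    equal? i j with i ℤ.≟ j
    ... | yes ≡.refl = just refl
    ... | no  _      = nothing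

  open Algebra.Solver.Ring ℤ.+-*-rawRing (fromCommutativeRing K) homomorphism equal? public
    using (Polynomial; con; _:+_; _:*_; _:-_; :-_; _:^_; _:×_; var; solve; _:=_; prove)

filter-∷-length : ∀ {a p} {A : Set a} {P : A → Set p} (P? : Decidable P) x xs →
  length (filter P? xs) ℕ.≤ length (filter P? (x ∷ xs))
filter-∷-length P? x xs with P? x
... | yes _ = ℕ.n≤1+n _
... | no  _ = ℕ.≤-refl

-- The matrices that commute with the permutation (1 2)(3 4).
swapSymmetric : ∀ {a} {A : Set a} → A → A → A → A → A → A → A → A → Fin 4 → Fin 4 → A
swapSymmetric p q r s t u v w i j = lookup (lookup
  ( (p ∷ q ∷ r ∷ s ∷ [])
  ∷ (q ∷ p ∷ s ∷ r ∷ [])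
  ∷ (t ∷ u ∷ v ∷ w ∷ [])
  ∷ (u ∷ t ∷ w ∷ v ∷ [])
  ∷ []) i) j

-- Characteristic polynomials and traces over a commutative ring

module CharacteristicPolynomials {c ℓ} (K : CommutativeRing c ℓ) where
  open CommutativeRing K hiding (zero)
  open IntegerCoefficients K
  open Algebra.Definitions.RawSemiring (Semiring.rawSemiring semiring) using (_^_; sum)
    renaming (_×_ to _·_)
  open SetoidReasoning setoid

  -- The determinant of Defs over an arbitrary commutative ring, where identities
  -- are in reach of the ring solver.
  det : ∀ {n} → (Fin n → Fin n → Carrier) → Carrier
  det {zero}  M = 1#
  det {suc n} M = sum λ j → (- 1#) ^ toℕ j * M zero j * det λ i k → M (suc i) (punchIn j k)

  characteristic : ∀ {n} → (Fin n → Fin n → Carrier) → Carrier → Carrier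
  characteristic A x = det λ i j → (if does (i Fin.≟ j) then x else 0#) + - A i j

  private
    -- Mirrors `det` in solver syntax. For a concrete size its interpretation unfolds to `det`, so
    -- determinant identities follow by normalisation without writing out any expansion.
    detP : ∀ {m n} → (Fin n → Fin n → Polynomial m) → Polynomial m
    detP {n = zero}  M = con (+ 1)
    detP {n = suc n} M = Vector.foldr _:+_ (con (+ 0))
      λ j → (:- con (+ 1)) :^ toℕ j :* M zero j :* detP λ i k → M (suc i) (punchIn j k)

    characteristicP : ∀ {m n} → (Fin n → Fin n → Polynomial m) → Polynomial m → Polynomial m
    characteristicP A x = detP λ i j → (if does (i Fin.≟ j) then x else con (+ 0)) :- A i j

  trace : ∀ {n} → (Fin n → Fin n → Carrier) → Carrier
  trace A = sum λ i → A i i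

  -- On polynomials of degree at most 3, evenDifference is 6 times the coefficient
  -- of x²; on those of degree at most 4, oddDifference is 12 times that of x³.
  evenDifference : (Carrier → Carrier) → Carrier
  evenDifference f = f (1# + 1#) - f 1# - f (- 1#) + f (- (1# + 1#))

  oddDifference : (Carrier → Carrier) → Carrier
  oddDifference f = f (1# + 1#) - f 1# - f 1# + f (- 1#) + f (- 1#) - f (- (1# + 1#))

  private
    two one : ∀ {m} → Polynomial m
    two = con (+ 1) :+ con (+ 1)
    one = con (+ 1)

    evenDifferenceP : ∀ {m} → (Polynomial m → Polynomial m) → Polynomial m
    evenDifferenceP f = f two :- f one :- f (:- one) :+ f (:- two)

    oddDifferenceP : ∀ {m} → (Polynomial m → Polynomial m) → Polynomial m
    oddDifferenceP f = f two :- f one :- f one :+ f (:- one) :+ f (:- one) :- f (:- two)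

    entries : (Fin 3 → Fin 3 → Carrier) → Vec Carrier 9
    entries A = Vec.concat (Vec.tabulate λ i → Vec.tabulate (A i))

    entriesP : Fin 3 → Fin 3 → Polynomial 9
    entriesP i j = var (combine i j)

  evenDifference-characteristic : ∀ A → evenDifference (characteristic {3} A) ≈ 6 · - trace A
  evenDifference-characteristic A = prove (entries A)
    (evenDifferenceP (characteristicP entriesP))
    (6 :× (:- Vector.foldr _:+_ (con (+ 0)) λ i → entriesP i i)) refl

  oddDifference-characteristic : ∀ A → oddDifference (characteristic {3} A) ≈ 12 · 1#
  oddDifference-characteristic A = prove (entries A)
    (oddDifferenceP (characteristicP entriesP)) (12 :× one) refl

  offDiagonalMinor : Fin 3 → (Fin 3 → Fin 3 → Carrier) → Carrier → Carrier
  offDiagonalMinor j B x = det λ i k →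
    (if does (suc i Fin.≟ punchIn (suc j) k) then x else 0#) - B i k

  private
    offDiagonalMinorP : ∀ {m} → Fin 3 → (Fin 3 → Fin 3 → Polynomial m) → Polynomial m → Polynomial m
    offDiagonalMinorP j B x = detP λ i k →
      (if does (suc i Fin.≟ punchIn (suc j) k) then x else con (+ 0)) :- B i k

  -- Deleting row 0 and column `suc j` removes two of the four diagonal occurrences of x, so the
  -- minor has degree at most 2 and no x³ term. The split on `j` lets the positions of the remaining
  -- two compute.
  oddDifference-minor : ∀ j B → oddDifference (offDiagonalMinor j B) ≈ 0#
  oddDifference-minor j@zero B = prove (entries B)
    (oddDifferenceP (offDiagonalMinorP j entriesP)) (con (+ 0)) refl
  oddDifference-minor j@(suc zero) B = prove (entries B)
    (oddDifferenceP (offDiagonalMinorP j entriesP)) (con (+ 0)) refl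
  oddDifference-minor j@(suc (suc zero)) B = prove (entries B)
    (oddDifferenceP (offDiagonalMinorP j entriesP)) (con (+ 0)) refl

  oddDifference-cong : ∀ {f g} → (∀ x → f x ≈ g x) → oddDifference f ≈ oddDifference g
  oddDifference-cong f≈g = +-cong (+-cong (+-cong (+-cong (+-cong (f≈g _) (-‿cong (f≈g _)))
    (-‿cong (f≈g _))) (f≈g _)) (f≈g _)) (-‿cong (f≈g _))

  oddDifference-+ : ∀ f g → oddDifference (λ x → f x + g x) ≈ oddDifference f + oddDifference g
  oddDifference-+ f g = solve 8
    (λ a b c d a′ b′ c′ d′ →
      a :+ a′ :- (b :+ b′) :- (b :+ b′) :+ (c :+ c′) :+ (c :+ c′) :- (d :+ d′) :=
      (a :- b :- b :+ c :+ c :- d) :+ (a′ :- b′ :- b′ :+ c′ :+ c′ :- d′))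
    refl _ _ _ _ _ _ _ _

  oddDifference-* : ∀ k f → oddDifference (λ x → k * f x) ≈ k * oddDifference f
  oddDifference-* k f = solve 5
    (λ k a b c d →
      k :* a :- k :* b :- k :* b :+ k :* c :+ k :* c :- k :* d :=
      k :* (a :- b :- b :+ c :+ c :- d))
    refl k _ _ _ _

  -- Multiplication by x turns the x² coefficient into the x³ coefficient; the normalisations 6 and
  -- 12 account for the doubled `evenDifference`.
  oddDifference-*-linear : ∀ k f → oddDifference (λ x → 1# * (x - k) * f x) ≈
                                   evenDifference f + evenDifference f - k * oddDifference f
  oddDifference-*-linear k f = solve 5
    (λ k a b c d →
      let g x y = one :* (x :- k) :* y in
      g two a :- g one b :- g one b :+ g (:- one) c :+ g (:- one) c :- g (:- two) d :=
      (a :- b :- c :+ d) :+ (a :- b :- c :+ d) :- k :* (a :- b :- b :+ c :+ c :- d))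
    refl k _ _ _ _

  oddDifference-cofactor : ∀ k j B → oddDifference (λ x → k * offDiagonalMinor j B x) ≈ 0#
  oddDifference-cofactor k j B = begin
    oddDifference (λ x → k * offDiagonalMinor j B x)  ≈⟨ oddDifference-* k (offDiagonalMinor j B) ⟩
    k * oddDifference (offDiagonalMinor j B)          ≈⟨ *-congˡ (oddDifference-minor j B) ⟩
    k * 0#                                            ≈⟨ zeroʳ k ⟩
    0#                                                ∎

  -- Laplace expansion along the first row: only the diagonal cofactor reaches degree 3, and the
  -- other three terms vanish under `oddDifference`. The solver thus meets only 3 × 3 determinants.
  oddDifference-characteristic₄ : ∀ A → oddDifference (characteristic {4} A) ≈ 12 · - trace A
  oddDifference-characteristic₄ A = begin
    oddDifference (characteristic A)
      ≈⟨ oddDifference-+ (λ x → 1# * (x - A zero zero) * characteristic A′ x) g₁ ⟩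
    oddDifference (λ x → 1# * (x - A zero zero) * characteristic A′ x) + oddDifference g₁
      ≈⟨ +-cong (oddDifference-*-linear (A zero zero) (characteristic A′)) g₁≈0 ⟩
    evenDifference (characteristic A′) + evenDifference (characteristic A′) -
      A zero zero * oddDifference (characteristic A′) + 0#
      ≈⟨ +-congʳ (+-cong
           (+-cong (evenDifference-characteristic A′) (evenDifference-characteristic A′))
           (-‿cong (*-congˡ (oddDifference-characteristic A′)))) ⟩
    6 · - trace A′ + 6 · - trace A′ - A zero zero * 12 · 1# + 0#
      ≈⟨ solve 2 (λ a t → (6 :× (:- t)) :+ (6 :× (:- t)) :- a :* (12 :× one) :+ con (+ 0) :=
                           12 :× (:- (a :+ t)))
               refl (A zero zero) (trace A′) ⟩
    12 · - trace A
      ∎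
    where
    A′ : Fin 3 → Fin 3 → Carrier
    A′ i j = A (suc i) (suc j)

    cofactor : Fin 3 → Carrier → Carrier
    cofactor j x = (- 1#) ^ toℕ (suc j) * (0# - A zero (suc j)) *
                   offDiagonalMinor j (λ i k → A (suc i) (punchIn (suc j) k)) x

    -- The successive tails of the Laplace sum, including the final `0#` of the fold.
    g₁ g₂ g₃ : Carrier → Carrier
    g₃ x = cofactor (suc (suc zero)) x + 0#
    g₂ x = cofactor (suc zero) x + g₃ x
    g₁ x = cofactor zero x + g₂ x

    cofactor≈0 : ∀ j → oddDifference (cofactor j) ≈ 0#
    cofactor≈0 j = oddDifference-cofactor _ j (λ i k → A (suc i) (punchIn (suc j) k))

    step : ∀ j g → oddDifference g ≈ 0# → oddDifference (λ x → cofactor j x + g x) ≈ 0#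
    step j g g≈0 = trans (oddDifference-+ (cofactor j) g)
      (trans (+-cong (cofactor≈0 j) g≈0) (+-identityˡ 0#))

    g₁≈0 : oddDifference g₁ ≈ 0#
    g₁≈0 = step zero g₂ (step (suc zero) g₃ (step (suc (suc zero)) (λ _ → 0#)
      (solve 0 (oddDifferenceP (λ _ → con (+ 0)) := con (+ 0)) refl)))

  rootProduct : Carrier → Carrier → Carrier → Carrier → Carrier → Carrier
  rootProduct a b c d x = (x - a) * ((x - b) * ((x - c) * ((x - d) * 1#)))

  oddDifference-rootProduct : ∀ a b c d →
    oddDifference (rootProduct a b c d) ≈ 12 · - (a + (b + (c + (d + 0#))))
  oddDifference-rootProduct = solve 4 (λ a b c d →
    oddDifferenceP (λ x → (x :- a) :* ((x :- b) :* ((x :- c) :* ((x :- d) :* one)))) :=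
    12 :× (:- (a :+ (b :+ (c :+ (d :+ con (+ 0))))))) refl

  trace-from-roots : ∀ A a b c d → (∀ x → characteristic A x ≈ rootProduct a b c d x) →
    12 · - trace A ≈ 12 · - (a + (b + (c + (d + 0#))))
  trace-from-roots A a b c d χ≈ = begin
    12 · - trace A                       ≈⟨ oddDifference-characteristic₄ A ⟨
    oddDifference (characteristic A)     ≈⟨ oddDifference-cong χ≈ ⟩
    oddDifference (rootProduct a b c d)  ≈⟨ oddDifference-rootProduct a b c d ⟩
    12 · - (a + (b + (c + (d + 0#))))    ∎

  sub-congˡ : ∀ {x y z} → y ≈ z → x - y ≈ x - z
  sub-congˡ y≈z = +-congˡ (-‿cong y≈z)

  -- Two families of matrices with prescribed eigenvalues

  module _ {a} {A : Set a} (f : A → Carrier) where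
    -- The first factor is the block on the vectors (x, x, y, y), the second the block on (x, -x, y,
    -- -y). Only the images of the entries under `f` occur, so `f` can be `ofReal` with no
    -- homomorphism law.
    characteristic-swapSymmetric : ∀ p q r s t u v w x →
      characteristic (λ i j → f (swapSymmetric p q r s t u v w i j)) x ≈
      ((x - (f p + f q)) * (x - (f v + f w)) - (f r + f s) * (f t + f u)) *
      ((x - (f p - f q)) * (x - (f v - f w)) - (f r - f s) * (f t - f u))
    characteristic-swapSymmetric p q r s t u v w x = solve 9 (λ p q r s t u v w x →
      characteristicP (swapSymmetric p q r s t u v w) x :=
      ((x :- (p :+ q)) :* (x :- (v :+ w)) :- (r :+ s) :* (t :+ u)) :*
      ((x :- (p :- q)) :* (x :- (v :- w)) :- (r :- s) :* (t :- u))) refl (f p) (f q) (f r) (f s)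
          (f t) (f u) (f v) (f w) x

    -- The eigenvalues are the values of the four characters of the Klein group on (p, q, r, s).
    klein : ∀ {a b c d} p q r s →
      f p + f q - (f r + f s) ≈ a →
      f p - f q - (f r - f s) ≈ b →
      f p - f q + (f r - f s) ≈ c →
      f p + f q + (f r + f s) ≈ d →
      ∀ x → characteristic (λ i j → f (swapSymmetric p q r s r s p q i j)) x ≈ rootProduct a b c d x
    klein {a} {b} {c} {d} p q r s ≈a ≈b ≈c ≈d x = begin
      characteristic (λ i j → f (swapSymmetric p q r s r s p q i j)) x
        ≈⟨ characteristic-swapSymmetric p q r s r s p q x ⟩
      _ ≈⟨ solve 5 (λ x p q r s →
             ((x :- (p :+ q)) :* (x :- (p :+ q)) :- (r :+ s) :* (r :+ s)) :*
             ((x :- (p :- q)) :* (x :- (p :- q)) :- (r :- s) :* (r :- s)) :=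
             (x :- (p :+ q :- (r :+ s))) :* ((x :- (p :- q :- (r :- s))) :*
             ((x :- (p :- q :+ (r :- s))) :* ((x :- (p :+ q :+ (r :+ s))) :* con (+ 1)))))
             refl x (f p) (f q) (f r) (f s) ⟩
      rootProduct _ _ _ _ x
        ≈⟨ *-cong (sub-congˡ ≈a) (*-cong (sub-congˡ ≈b) (*-cong (sub-congˡ ≈c) (*-congʳ (sub-congˡ
            ≈d)))) ⟩
      rootProduct a b c d x ∎

    -- Equal entries in each off-diagonal block make the antisymmetric block diagonal, with entries
    -- a and b. The symmetric block has rows (α, α - c) and (d - α, d + c - α), so its trace is c +
    -- d and its determinant c d for every α. Splitting the product (α - c)(d - α) into these two
    -- entries avoids a square root.
    coupled : ∀ {a b c d} α p q r t v w →
      f p + f q ≈ α → f p - f q ≈ a →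
      f v + f w ≈ d + c - α → f v - f w ≈ b →
      f r + f r ≈ α - c → f t + f t ≈ d - α →
      ∀ x → characteristic (λ i j → f (swapSymmetric p q r r t t v w i j)) x ≈ rootProduct a b c d x
    coupled {a} {b} {c} {d} α p q r t v w p+q p-q v+w v-w r+r t+t x = begin
      characteristic (λ i j → f (swapSymmetric p q r r t t v w i j)) x
        ≈⟨ characteristic-swapSymmetric p q r r t t v w x ⟩
      _ ≈⟨ *-cong (+-cong (*-cong (sub-congˡ p+q) (sub-congˡ v+w)) (-‿cong (*-cong r+r t+t)))
                  (+-congʳ (*-cong (sub-congˡ p-q) (sub-congˡ v-w))) ⟩
      ((x - α) * (x - (d + c - α)) - (α - c) * (d - α)) *
      ((x - a) * (x - b) - (f r - f r) * (f t - f t))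
        ≈⟨ solve 8 (λ x a b c d α r t →
             ((x :- α) :* (x :- (d :+ c :- α)) :- (α :- c) :* (d :- α)) :*
             ((x :- a) :* (x :- b) :- (r :- r) :* (t :- t)) :=
             (x :- a) :* ((x :- b) :* ((x :- c) :* ((x :- d) :* con (+ 1)))))
             refl x a b c d α (f r) (f t) ⟩
      rootProduct a b c d x ∎

module RealSpectra (𝓡 : Reals) where
  open Spectra 𝓡

  decTotalOrder : DecTotalOrder _ _ _
  decTotalOrder = record { isDecTotalOrder = isDecTotalOrder }

  module R = CommutativeRing commutativeRing
  open R using (_-_)
  open IntegerCoefficients commutativeRing

  -- Ordered field arithmetic

  x≤y⇒0≤y-x : ∀ {x y} → x ≤ y → 0# ≤ y - x
  x≤y⇒0≤y-x {x} x≤y = Order.≤-respˡ-≈ (R.-‿inverseʳ x) (+-monoˡ-≤ (- x) x≤y)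

  0≤y-x⇒x≤y : ∀ {x y} → 0# ≤ y - x → x ≤ y
  0≤y-x⇒x≤y {x} {y} 0≤y-x = Order.≤-respˡ-≈ (R.+-identityˡ x)
    (Order.≤-respʳ-≈ (solve 2 (λ x y → y :- x :+ x := y) R.refl x y) (+-monoˡ-≤ x 0≤y-x))

  x<y⇒0<y-x : ∀ {x y} → x < y → 0# < y - x
  x<y⇒0<y-x {x} {y} (x≤y , x≉y) = x≤y⇒0≤y-x x≤y , λ 0≈y-x → x≉y (begin
    x            ≈⟨ R.+-identityˡ x ⟨
    0# + x       ≈⟨ R.+-congʳ 0≈y-x ⟩
    y - x + x    ≈⟨ solve 2 (λ x y → y :- x :+ x := y) R.refl x y ⟩
    y            ∎)
    where open SetoidReasoning R.setoid

  0<y-x⇒x<y : ∀ {x y} → 0# < y - x → x < y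
  0<y-x⇒x<y {x} (0≤y-x , 0≉y-x) = 0≤y-x⇒x≤y 0≤y-x , λ x≈y →
    0≉y-x (R.trans (R.sym (R.-‿inverseʳ x)) (R.+-congʳ x≈y))

  0≤-resp : ∀ {x y} → x R.≈ y → 0# ≤ x → 0# ≤ y
  0≤-resp = Order.≤-respʳ-≈

  0<-resp : ∀ {x y} → x R.≈ y → 0# < x → 0# < y
  0<-resp x≈y (0≤x , 0≉x) = 0≤-resp x≈y 0≤x , λ 0≈y → 0≉x (R.trans 0≈y (R.sym x≈y))

  <-≰ : ∀ {x y} → x < y → ¬ y ≤ x
  <-≰ (x≤y , x≉y) y≤x = x≉y (Order.antisym x≤y y≤x)

  ≰-< : ∀ {x y} → ¬ y ≤ x → x < y
  ≰-< {x} {y} y≰x with Order.total x y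
  ... | inj₁ x≤y = x≤y , λ x≈y → y≰x (Order.reflexive (R.sym x≈y))
  ... | inj₂ y≤x = contradiction y≤x y≰x

  ≤-or-> : ∀ x y → x ≤ y ⊎ y < x
  ≤-or-> x y with x Order.≤? y
  ... | yes x≤y = inj₁ x≤y
  ... | no  x≰y = inj₂ (≰-< x≰y)

  <-≤-trans : ∀ {x y z} → x < y → y ≤ z → x < z
  <-≤-trans x<y y≤z = Order.trans (proj₁ x<y) y≤z , λ x≈z →
    <-≰ x<y (Order.≤-respʳ-≈ (R.sym x≈z) y≤z)

  ≤-<-trans : ∀ {x y z} → x ≤ y → y < z → x < z
  ≤-<-trans x≤y y<z = Order.trans x≤y (proj₁ y<z) , λ x≈z →
    <-≰ y<z (Order.≤-respˡ-≈ x≈z x≤y)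

  +-nonNegative : ∀ {x y} → 0# ≤ x → 0# ≤ y → 0# ≤ x + y
  +-nonNegative {x} {y} 0≤x 0≤y = Order.trans 0≤y
    (Order.≤-respˡ-≈ (R.+-identityˡ y) (+-monoˡ-≤ y 0≤x))

  +-positive : ∀ {x y} → 0# < x → 0# ≤ y → 0# < x + y
  +-positive {x} {y} 0<x 0≤y = <-≤-trans 0<x
    (Order.≤-respˡ-≈ (R.+-identityˡ x) (Order.≤-respʳ-≈ (R.+-comm y x) (+-monoˡ-≤ x 0≤y)))

  x*y≈0⇒x≈0∨y≈0 : ∀ {x y} → x * y R.≈ 0# → x R.≈ 0# ⊎ y R.≈ 0#
  x*y≈0⇒x≈0∨y≈0 {x} {y} xy≈0 with x Order.≟ 0#
  ... | yes x≈0 = inj₁ x≈0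
  ... | no  x≉0 = inj₂ (let x⁻¹ , xx⁻¹≈1 = inverse x x≉0 in begin
    y                ≈⟨ R.*-identityˡ y ⟨
    1# * y           ≈⟨ R.*-congʳ xx⁻¹≈1 ⟨
    x * x⁻¹ * y      ≈⟨ solve 3 (λ x z y → x :* z :* y := z :* (x :* y)) R.refl x x⁻¹ y ⟩
    x⁻¹ * (x * y)    ≈⟨ R.*-congˡ xy≈0 ⟩
    x⁻¹ * 0#         ≈⟨ R.zeroʳ x⁻¹ ⟩
    0#               ∎)
    where open SetoidReasoning R.setoid

  *-positive : ∀ {x y} → 0# < x → 0# < y → 0# < x * y
  *-positive (0≤x , 0≉x) (0≤y , 0≉y) = *-nonNegative 0≤x 0≤y ,
    [ 0≉x ∘ R.sym , 0≉y ∘ R.sym ]′ ∘ x*y≈0⇒x≈0∨y≈0 ∘ R.sym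

  x≤0⇒0≤-x : ∀ {x} → x ≤ 0# → 0# ≤ - x
  x≤0⇒0≤-x {x} x≤0 = 0≤-resp (R.+-identityˡ (- x)) (x≤y⇒0≤y-x x≤0)

  x²-nonNegative : ∀ x → 0# ≤ x * x
  x²-nonNegative x with Order.total 0# x
  ... | inj₁ 0≤x = *-nonNegative 0≤x 0≤x
  ... | inj₂ x≤0 = 0≤-resp (solve 1 (λ x → :- x :* :- x := x :* x) R.refl x)
                           (*-nonNegative (x≤0⇒0≤-x x≤0) (x≤0⇒0≤-x x≤0))

  0<1 : 0# < 1#
  0<1 = 0≤-resp (R.*-identityˡ 1#) (x²-nonNegative 1#) , 0≉1

  0<2 : 0# < 1# + 1#
  0<2 = +-positive 0<1 (proj₁ 0<1)

  private
    ½ : ℝ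
    ½ = proj₁ (inverse (1# + 1#) λ 2≈0 → proj₂ 0<2 (R.sym 2≈0))

    ½+½≈1 : ½ + ½ R.≈ 1#
    ½+½≈1 = R.trans (solve 1 (λ h → h :+ h := (con (+ 1) :+ con (+ 1)) :* h) R.refl ½)
                    (proj₂ (inverse (1# + 1#) λ 2≈0 → proj₂ 0<2 (R.sym 2≈0)))

    0<½ : 0# < ½
    0<½ = ≰-< λ ½≤0 → <-≰ 0<1 (0≤y-x⇒x≤y (0≤-resp (R.trans
      (solve 1 (λ h → :- h :+ :- h := con (+ 0) :- (h :+ h)) R.refl ½) (R.+-congˡ (R.-‿cong ½+½≈1)))
      (+-nonNegative (x≤0⇒0≤-x ½≤0) (x≤0⇒0≤-x ½≤0))))

  half : ℝ → ℝ
  half x = ½ * x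

  half-double : ∀ x → half x + half x R.≈ x
  half-double x = R.trans (R.sym (R.distribʳ x ½ ½)) (R.trans (R.*-congʳ ½+½≈1) (R.*-identityˡ x))

  half-+ : ∀ x y → half (x + y) R.≈ half x + half y
  half-+ = R.distribˡ ½

  half-sub : ∀ x y → half (x - y) R.≈ half x - half y
  half-sub = solve 3 (λ h x y → h :* (x :- y) := h :* x :- h :* y) R.refl ½

  half-nonNegative : ∀ {x} → 0# ≤ x → 0# ≤ half x
  half-nonNegative = *-nonNegative (proj₁ 0<½)

  half-positive : ∀ {x} → 0# < x → 0# < half x
  half-positive = *-positive 0<½

  half-sum : ∀ x y → half (x + y) + half (x - y) R.≈ x
  half-sum x y = R.trans (R.+-cong (half-+ x y) (half-sub x y)) (R.trans
    (solve 2 (λ x y → x :+ y :+ (x :- y) := x :+ x) R.refl (half x) (half y)) (half-double x))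

  half-difference : ∀ x y → half (x + y) - half (x - y) R.≈ y
  half-difference x y = R.trans (R.+-cong (half-+ x y) (R.-‿cong (half-sub x y))) (R.trans
    (solve 2 (λ x y → x :+ y :- (x :- y) := y :+ y) R.refl (half x) (half y)) (half-double y))

  -- Complex numbers and determinants

  ℂ-isCommutativeRing : IsCommutativeRing _≈ᶜ_ _+ᶜ_ _*ᶜ_ -ᶜ_ 0ᶜ 1ᶜ
  ℂ-isCommutativeRing = record
    { isRing = record
      { +-isAbelianGroup = record
        { isGroup = record
          { isMonoid = record
            { isSemigroup = record
              { isMagma = record
                { isEquivalence = isEquivalence
                ; ∙-cong = λ p q → R.+-cong (re≈ p) (re≈ q) , R.+-cong (im≈ p) (im≈ q)
                }
              ; assoc = λ x y z → R.+-assoc (re x) (re y) (re z) , R.+-assoc (im x) (im y) (im z)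
              }
            ; identity = (λ x → R.+-identityˡ (re x) , R.+-identityˡ (im x))
                       , (λ x → R.+-identityʳ (re x) , R.+-identityʳ (im x))
            }
          ; inverse = (λ x → R.-‿inverseˡ (re x) , R.-‿inverseˡ (im x))
                    , (λ x → R.-‿inverseʳ (re x) , R.-‿inverseʳ (im x))
          ; ⁻¹-cong = λ p → R.-‿cong (re≈ p) , R.-‿cong (im≈ p)
          }
        ; comm = λ x y → R.+-comm (re x) (re y) , R.+-comm (im x) (im y)
        }
      ; *-cong = λ p q → R.+-cong (R.*-cong (re≈ p) (re≈ q)) (R.-‿cong (R.*-cong (im≈ p) (im≈ q)))
                       , R.+-cong (R.*-cong (re≈ p) (im≈ q)) (R.*-cong (im≈ p) (re≈ q))
      ; *-assoc = λ x y z →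
          solve 6 (λ a b c d e f → (a :* c :- b :* d) :* e :- (a :* d :+ b :* c) :* f :=
                                   a :* (c :* e :- d :* f) :- b :* (c :* f :+ d :* e))
            R.refl (re x) (im x) (re y) (im y) (re z) (im z) ,
          solve 6 (λ a b c d e f → (a :* c :- b :* d) :* f :+ (a :* d :+ b :* c) :* e :=
                                   a :* (c :* f :+ d :* e) :+ b :* (c :* e :- d :* f))
            R.refl (re x) (im x) (re y) (im y) (re z) (im z)
      ; *-identity =
          (λ x → solve 2 (λ a b → con (+ 1) :* a :- con (+ 0) :* b := a) R.refl (re x) (im x) ,
                 solve 2 (λ a b → con (+ 1) :* b :+ con (+ 0) :* a := b) R.refl (re x) (im x)) ,
          (λ x → solve 2 (λ a b → a :* con (+ 1) :- b :* con (+ 0) := a) R.refl (re x) (im x) ,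
                 solve 2 (λ a b → a :* con (+ 0) :+ b :* con (+ 1) := b) R.refl (re x) (im x))
      ; distrib =
          (λ x y z →
            solve 6 (λ a b c d e f → a :* (c :+ e) :- b :* (d :+ f) :=
                                     a :* c :- b :* d :+ (a :* e :- b :* f))
              R.refl (re x) (im x) (re y) (im y) (re z) (im z) ,
            solve 6 (λ a b c d e f → a :* (d :+ f) :+ b :* (c :+ e) :=
                                     a :* d :+ b :* c :+ (a :* f :+ b :* e))
              R.refl (re x) (im x) (re y) (im y) (re z) (im z)) ,
          (λ x y z →
            solve 6 (λ a b c d e f → (c :+ e) :* a :- (d :+ f) :* b :=
                                     c :* a :- d :* b :+ (e :* a :- f :* b))
              R.refl (re x) (im x) (re y) (im y) (re z) (im z) ,
            solve 6 (λ a b c d e f → (c :+ e) :* b :+ (d :+ f) :* a :=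
                                     c :* b :+ d :* a :+ (e :* b :+ f :* a))
              R.refl (re x) (im x) (re y) (im y) (re z) (im z))
      }
    ; *-comm = λ x y →
        solve 4 (λ a b c d → a :* c :- b :* d := c :* a :- d :* b)
          R.refl (re x) (im x) (re y) (im y) ,
        solve 4 (λ a b c d → a :* d :+ b :* c := c :* b :+ d :* a)
          R.refl (re x) (im x) (re y) (im y)
    }
    where open Setoid ℂ-setoid using (isEquivalence)

  ℂ-commutativeRing : CommutativeRing _ _
  ℂ-commutativeRing = record { isCommutativeRing = ℂ-isCommutativeRing }

  module C = CommutativeRing ℂ-commutativeRing
  module χ = CharacteristicPolynomials ℂ-commutativeRing

  det≈ : ∀ {n} (M : Matrix ℂ n) → det M ≈ᶜ χ.det M
  det≈ {zero}  M = C.refl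
  det≈ {suc n} M = Sum.sum-cong-≋ C.+-monoid λ j →
    C.*-congˡ {(-ᶜ 1ᶜ) ^ toℕ j *ᶜ M zero j} (det≈ (λ i k → M (suc i) (punchIn j k)))

  characteristicPolynomial≈ : ∀ {n} (A : Matrix ℝ n) x →
    characteristicPolynomial A x ≈ᶜ χ.characteristic (λ i j → ofReal (A i j)) x
  characteristicPolynomial≈ A x =
    det≈ (λ i j → (if does (i Fin.≟ j) then x else 0ᶜ) -ᶜ ofReal (A i j))

  polynomialWithRoots-↭ : ∀ {σ τ} → σ ↭ τ → ∀ x →
    polynomialWithRoots (map ofReal σ) x ≈ᶜ polynomialWithRoots (map ofReal τ) x
  polynomialWithRoots-↭ ↭.refl          x = C.refl
  polynomialWithRoots-↭ (↭.prep _ σ↭τ)  x = C.*-congˡ (polynomialWithRoots-↭ σ↭τ x)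
  polynomialWithRoots-↭ (↭.swap a b σ↭τ) x = C.trans
    (C.*-congˡ (C.*-congˡ (polynomialWithRoots-↭ σ↭τ x)))
    (x∙yz≈y∙xz (x -ᶜ ofReal a) (x -ᶜ ofReal b) _)
    where open Algebra.Properties.CommutativeSemigroup C.*-commutativeSemigroup using (x∙yz≈y∙xz)
  polynomialWithRoots-↭ (↭.trans σ↭τ τ↭υ) x =
    C.trans (polynomialWithRoots-↭ σ↭τ x) (polynomialWithRoots-↭ τ↭υ x)

  -- Irreducible realizations

  Connected : ∀ {n} → Matrix ℝ n → Set
  Connected A = ∀ i j → Star (λ u v → ¬ A u v R.≈ 0#) i j

  -- Nonzero entries are the edges of a graph. The zero block forbids edges from positions at least
  -- `k` to positions below `k`, so no path can cross that way.
  connected⇒irreducible : ∀ {n} {A : Matrix ℝ n} → Connected A → Irreducible A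
  connected⇒irreducible {n} {A} connected (π , k , 0<k , k<n , zeros) =
    ℕ.<⇒≱ (closed (connected (π ⟨$⟩ʳ last) (π ⟨$⟩ʳ first))
               (≡.subst (ℕ._< k) (≡.sym (position (ℕ.<-trans 0<k k<n))) 0<k))
      (ℕ.≤-reflexive (≡.sym (position k<n)))
    where
    first last : Fin n
    first = fromℕ< (ℕ.<-trans 0<k k<n)
    -- Index `k`, the first one outside the low block; it exists because `k < n`.
    last  = fromℕ< k<n

    Low : Fin n → Set
    Low v = toℕ (π ⟨$⟩ˡ v) ℕ.< k

    position : ∀ {m} (m<n : m ℕ.< n) → toℕ (π ⟨$⟩ˡ (π ⟨$⟩ʳ fromℕ< m<n)) ≡ m
    position m<n = ≡.trans (≡.cong toℕ (inverseˡ π)) (Fin.toℕ-fromℕ< m<n)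

    step : ∀ {u v} → ¬ A u v R.≈ 0# → Low v → Low u
    step {u} {v} edge v-low with toℕ (π ⟨$⟩ˡ u) ℕ.<? k
    ... | yes u-low = u-low
    ... | no ¬u-low = contradiction
      (≡.subst₂ (λ u v → A u v R.≈ 0#) (inverseʳ π) (inverseʳ π)
        (zeros (π ⟨$⟩ˡ u) (π ⟨$⟩ˡ v) (ℕ.≮⇒≥ ¬u-low) v-low)) edge

    closed : ∀ {u v} → Star (λ u v → ¬ A u v R.≈ 0#) u v → Low v → Low u
    closed ε          v-low = v-low
    closed (edge ◅ p) v-low = step edge (closed p v-low)

  -- The entries `r` and `u` alone form the 4-cycle 0 → 2 → 1 → 3 → 0.
  swapSymmetric-connected : ∀ {p q r s t u v w} → 0# < r → 0# < u →
    Connected (swapSymmetric p q r s t u v w)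
  swapSymmetric-connected {p} {q} {r} {s} {t} {u} {v} {w} 0<r 0<u i j = to0 i ◅◅ from0 j
    where
    Path : Fin 4 → Fin 4 → Set
    Path = Star (λ i j → ¬ swapSymmetric p q r s t u v w i j R.≈ 0#)

    ≉0 : ∀ {x} → 0# < x → ¬ x R.≈ 0#
    ≉0 (_ , 0≉x) x≈0 = 0≉x (R.sym x≈0)

    0→2 : Path zero (suc (suc zero))
    0→2 = ≉0 0<r ◅ ε

    2→1 : Path (suc (suc zero)) (suc zero)
    2→1 = ≉0 0<u ◅ ε

    1→3 : Path (suc zero) (suc (suc (suc zero)))
    1→3 = ≉0 0<r ◅ ε

    3→0 : Path (suc (suc (suc zero))) zero
    3→0 = ≉0 0<u ◅ ε

    to0 : ∀ i → Path i zero
    to0 zero                   = ε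
    to0 (suc zero)             = 1→3 ◅◅ 3→0
    to0 (suc (suc zero))       = 2→1 ◅◅ 1→3 ◅◅ 3→0
    to0 (suc (suc (suc zero))) = 3→0

    from0 : ∀ i → Path zero i
    from0 zero                   = ε
    from0 (suc zero)             = 0→2 ◅◅ 2→1
    from0 (suc (suc zero))       = 0→2
    from0 (suc (suc (suc zero))) = 0→2 ◅◅ 2→1 ◅◅ 1→3

  swapSymmetric-nonNegative : ∀ {p q r s t u v w} → 0# ≤ p → 0# ≤ q → 0# ≤ r → 0# ≤ s →
    0# ≤ t → 0# ≤ u → 0# ≤ v → 0# ≤ w → NonNegative (swapSymmetric p q r s t u v w)
  swapSymmetric-nonNegative {p} {q} {r} {s} {t} {u} {v} {w} 0≤p 0≤q 0≤r 0≤s 0≤t 0≤u 0≤v 0≤w i j =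
    lookup⁺ {P = 0# ≤_} (lookup⁺ {P = VecAll.All (0# ≤_)}
      ( (0≤p ∷ 0≤q ∷ 0≤r ∷ 0≤s ∷ [])
      ∷ (0≤q ∷ 0≤p ∷ 0≤s ∷ 0≤r ∷ [])
      ∷ (0≤t ∷ 0≤u ∷ 0≤v ∷ 0≤w ∷ [])
      ∷ (0≤u ∷ 0≤t ∷ 0≤w ∷ 0≤v ∷ [])
      ∷ []) i) j
    where open VecAll using (_∷_; [])

  ofReal-cong : ∀ {x y} → x R.≈ y → ofReal x ≈ᶜ ofReal y
  ofReal-cong x≈y = x≈y , R.refl

  ofReal-+ : ∀ x y → ofReal (x + y) ≈ᶜ ofReal x +ᶜ ofReal y
  ofReal-+ x y = R.refl , R.sym (R.+-identityˡ 0#)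

  ofReal-neg : ∀ x → ofReal (- x) ≈ᶜ -ᶜ ofReal x
  ofReal-neg x = R.refl , solve 0 (con (+ 0) := :- con (+ 0)) R.refl

  ofReal-sub : ∀ x y → ofReal (x - y) ≈ᶜ ofReal x -ᶜ ofReal y
  ofReal-sub x y = C.trans (ofReal-+ x (- y)) (C.+-congˡ (ofReal-neg y))

  ofReal-* : ∀ x y → ofReal (x * y) ≈ᶜ ofReal x *ᶜ ofReal y
  ofReal-* x y =
    solve 2 (λ x y → x :* y := x :* y :- con (+ 0) :* con (+ 0)) R.refl x y ,
    solve 2 (λ x y → con (+ 0) := x :* con (+ 0) :+ con (+ 0) :* y) R.refl x y

  -- The size is an index of its own, so that explicit 4 × 4 matrices can be given although the
  -- length of a variable list does not compute.
  IrreduciblyRealizableBy : ℕ → List ℝ → Set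
  IrreduciblyRealizableBy n σ = ∃ λ
      (A : Matrix ℝ n) → NonNegative A × Irreducible A × HasSpectrum A (map ofReal σ)

  ofReal-sum : ∀ {x y z} → x + y R.≈ z → ofReal x +ᶜ ofReal y ≈ᶜ ofReal z
  ofReal-sum {x} {y} eq = C.trans (C.sym (ofReal-+ x y)) (ofReal-cong eq)

  ofReal-difference : ∀ {x y z} → x - y R.≈ z → ofReal x -ᶜ ofReal y ≈ᶜ ofReal z
  ofReal-difference {x} {y} eq = C.trans (C.sym (ofReal-sub x y)) (ofReal-cong eq)

  klein-realization : ∀ {a b c d} p q r s → 0# ≤ p → 0# ≤ q → 0# < r → 0# < s →
    p + q - (r + s) R.≈ a → p - q - (r - s) R.≈ b → p - q + (r - s) R.≈ c → p + q + (r + s) R.≈ d →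
    IrreduciblyRealizableBy 4 (a ∷ b ∷ c ∷ d ∷ [])
  klein-realization p q r s 0≤p 0≤q 0<r 0<s ≈a ≈b ≈c ≈d =
    swapSymmetric p q r s r s p q ,
    swapSymmetric-nonNegative 0≤p 0≤q (proj₁ 0<r) (proj₁ 0<s) (proj₁ 0<r) (proj₁ 0<s) 0≤p 0≤q ,
    connected⇒irreducible (swapSymmetric-connected 0<r 0<s) ,
    λ x → C.trans (characteristicPolynomial≈ (swapSymmetric p q r s r s p q) x)
      (χ.klein ofReal p q r s
        (C.trans (C.+-cong (C.sym (ofReal-+ p q)) (C.-‿cong (C.sym (ofReal-+ r s))))
            (ofReal-difference ≈a))
        (C.trans (C.+-cong (C.sym (ofReal-sub p q)) (C.-‿cong (C.sym (ofReal-sub r s))))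
            (ofReal-difference ≈b))
        (C.trans (C.+-cong (C.sym (ofReal-sub p q)) (C.sym (ofReal-sub r s))) (ofReal-sum ≈c))
        (C.trans (C.+-cong (C.sym (ofReal-+ p q)) (C.sym (ofReal-+ r s))) (ofReal-sum ≈d))
        x)

  coupled-realization : ∀ {a b c d} α p q r t v w →
    0# ≤ p → 0# ≤ q → 0# < r → 0# < t → 0# ≤ v → 0# ≤ w →
    p + q R.≈ α → p - q R.≈ a → v + w R.≈ d + c - α → v - w R.≈ b →
    r + r R.≈ α - c → t + t R.≈ d - α →
    IrreduciblyRealizableBy 4 (a ∷ b ∷ c ∷ d ∷ [])
  coupled-realization {a} {b} {c} {d} α p q r t v w
    0≤p 0≤q 0<r 0<t 0≤v 0≤w p+q p-q v+w v-w r+r t+t =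
    swapSymmetric p q r r t t v w ,
    swapSymmetric-nonNegative 0≤p 0≤q (proj₁ 0<r) (proj₁ 0<r) (proj₁ 0<t) (proj₁ 0<t) 0≤v 0≤w ,
    connected⇒irreducible (swapSymmetric-connected 0<r 0<t) ,
    λ x → C.trans (characteristicPolynomial≈ (swapSymmetric p q r r t t v w) x)
      (χ.coupled ofReal (ofReal α) p q r t v w (ofReal-sum p+q) (ofReal-difference p-q)
        (C.trans (ofReal-sum v+w) (C.trans (ofReal-sub (d + c) α) (C.+-congʳ (ofReal-+ d c))))
        (ofReal-difference v-w) (C.trans (ofReal-sum r+r) (ofReal-sub α c)) (C.trans
            (ofReal-sum t+t) (ofReal-sub d α)) x)

  -- The entries invert the character table. The last two hypotheses say that p and q are
  -- nonnegative; r and s are positive because d - a exceeds c - b by (d - c) + (b - a) and c - b is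
  -- nonnegative.
  klein-sorted : ∀ {a b c d} → a ≤ b → b ≤ c → c < d →
    0# ≤ d + a + (c + b) → 0# ≤ d + a - (c + b) → IrreduciblyRealizableBy 4 (a ∷ b ∷ c ∷ d ∷ [])
  klein-sorted {a} {b} {c} {d} a≤b b≤c c<d 0≤X+Y 0≤X-Y =
    klein-realization (half (X + Y)) (half (X - Y)) (half (U + V)) (half (U - V))
      (half-nonNegative (0≤-resp (half-+ _ _) (half-nonNegative 0≤X+Y)))
      (half-nonNegative (0≤-resp (half-sub _ _) (half-nonNegative 0≤X-Y)))
      (half-positive (0<-resp (half-+ _ _) (half-positive (0<-resp
        (solve 4 (λ a b c d → (d :- c) :+ (c :- b :+ (b :- a) :+ (c :- b)) := d :- a :+ (c :- b))
            R.refl a b c d)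
        (+-positive (x<y⇒0<y-x c<d) (+-nonNegative (+-nonNegative (x≤y⇒0≤y-x b≤c) (x≤y⇒0≤y-x a≤b))
            (x≤y⇒0≤y-x b≤c)))))))
      (half-positive (0<-resp (half-sub _ _) (half-positive (0<-resp
        (solve 4 (λ a b c d → (d :- c) :+ (b :- a) := d :- a :- (c :- b)) R.refl a b c d)
        (+-positive (x<y⇒0<y-x c<d) (x≤y⇒0≤y-x a≤b))))))
      (R.trans (R.+-cong (half-sum X Y) (R.-‿cong (half-sum U V))) (half-difference d a))
      (R.trans (R.+-cong (half-difference X Y) (R.-‿cong (half-difference U V)))
          (half-difference c b))
      (R.trans (R.+-cong (half-difference X Y) (half-difference U V)) (half-sum c b))
      (R.trans (R.+-cong (half-sum X Y) (half-sum U V)) (half-sum d a))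
    where
    X Y U V : ℝ
    X = half (d + a)
    Y = half (c + b)
    U = half (d - a)
    V = half (c - b)

  -- Here `m` plays the role of max(c, -a). The parameter α must exceed c for r > 0, be at least -a
  -- for p ≥ 0, and stay below d for t > 0; the midpoint of m and d does all three. The entry v is
  -- half of (d - α) + (c + b), which is where c + b ≥ 0 enters.
  coupled-sorted : ∀ {a b c d} m → a ≤ b → b ≤ c → c ≤ m → - a ≤ m → m < d →
    0# ≤ c + b → IrreduciblyRealizableBy 4 (a ∷ b ∷ c ∷ d ∷ [])
  coupled-sorted {a} {b} {c} {d} m a≤b b≤c c≤m -a≤m m<d 0≤c+b =
    coupled-realization α (half (α + a)) (half (α - a)) (half (α - c)) (half (d - α))
      (half (d + c - α + b)) (half (d + c - α - b))
      (half-nonNegative (0≤-resp (solve 3 (λ α m a → α :- m :+ (m :- :- a) := α :+ a) R.refl α m a)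
        (+-nonNegative (proj₁ 0<α-m) (x≤y⇒0≤y-x -a≤m))))
      (half-nonNegative (0≤-resp (solve 5
          (λ α m a b c → α :- m :+ (m :- c :+ (c :- b :+ (b :- a))) := α :- a) R.refl α m a b c)
        (+-nonNegative (proj₁ 0<α-m) (+-nonNegative 0≤m-c (+-nonNegative 0≤c-b (x≤y⇒0≤y-x a≤b))))))
      (half-positive (0<-resp (solve 3 (λ α m c → α :- m :+ (m :- c) := α :- c) R.refl α m c)
        (+-positive 0<α-m 0≤m-c)))
      (half-positive 0<d-α)
      (half-nonNegative (0≤-resp (solve 4 (λ α b c d → d :- α :+ (c :+ b) := d :+ c :- α :+ b)
          R.refl α b c d)
        (+-nonNegative (proj₁ 0<d-α) 0≤c+b)))
      (half-nonNegative (0≤-resp (solve 4 (λ α b c d → d :- α :+ (c :- b) := d :+ c :- α :- b)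
          R.refl α b c d)
        (+-nonNegative (proj₁ 0<d-α) 0≤c-b)))
      (half-sum α a) (half-difference α a)
      (half-sum (d + c - α) b) (half-difference (d + c - α) b)
      (half-double (α - c)) (half-double (d - α))
    where
    α : ℝ
    α = half (d + m)

    0<½[d-m] : 0# < half (d - m)
    0<½[d-m] = half-positive (x<y⇒0<y-x m<d)

    0<α-m : 0# < α - m
    0<α-m = 0<-resp (begin
      half (d - m)            ≈⟨ solve 2 (λ x y → x := y :- (y :- x)) R.refl (half (d - m)) α ⟩
      α - (α - half (d - m))  ≈⟨ R.+-congˡ (R.-‿cong (half-difference d m)) ⟩
      α - m                   ∎) 0<½[d-m]
      where open SetoidReasoning R.setoid

    0<d-α : 0# < d - α
    0<d-α = 0<-resp (begin
      half (d - m)              ≈⟨ solve 2 (λ x y → x := y :+ x :- y) R.refl (half (d - m)) α ⟩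
      α + half (d - m) - α      ≈⟨ R.+-congʳ (half-sum d m) ⟩
      d - α                     ∎) 0<½[d-m]
      where open SetoidReasoning R.setoid

    0≤m-c : 0# ≤ m - c
    0≤m-c = x≤y⇒0≤y-x c≤m

    0≤c-b : 0# ≤ c - b
    0≤c-b = x≤y⇒0≤y-x b≤c

  -- For c + b < 0 the Klein condition d + a ≥ c + b is automatic. Otherwise the comparison of -a
  -- with c selects the larger of the two as `m`.
  dominant⇒realization : ∀ {a b c d} → a ≤ b → b ≤ c → c < d → 0# < d + a →
    0# ≤ d + a + (c + b) → IrreduciblyRealizableBy 4 (a ∷ b ∷ c ∷ d ∷ [])
  dominant⇒realization {a} {b} {c} {d} a≤b b≤c c<d 0<d+a 0≤sum
    with ≤-or-> 0# (c + b) | Order.total (- a) c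
  ... | inj₁ 0≤c+b | inj₁ -a≤c = coupled-sorted c a≤b b≤c Order.refl -a≤c c<d 0≤c+b
  ... | inj₁ 0≤c+b | inj₂ c≤-a = coupled-sorted (- a) a≤b b≤c c≤-a Order.refl
    (0<y-x⇒x<y (0<-resp (solve 2 (λ a d → d :+ a := d :- :- a) R.refl a d) 0<d+a)) 0≤c+b
  ... | inj₂ c+b<0 | _ = klein-sorted a≤b b≤c c<d 0≤sum
    (0≤-resp (solve 2 (λ x y → x :+ (con (+ 0) :- y) := x :- y) R.refl (d + a) (c + b))
      (+-nonNegative (proj₁ 0<d+a) (x≤y⇒0≤y-x (proj₁ c+b<0))))

  -- Nonnegativity of the sum, from the trace

  open Algebra.Definitions.RawSemiring (Semiring.rawSemiring R.semiring) public
    using () renaming (_×_ to _·_)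

  ·-nonNegative : ∀ n {x} → 0# ≤ x → 0# ≤ n · x
  ·-nonNegative zero    0≤x = Order.refl
  ·-nonNegative (suc n) 0≤x = +-nonNegative 0≤x (·-nonNegative n 0≤x)

  ·-positive : ∀ n {x} → 0# < x → 0# < suc n · x
  ·-positive n 0<x = +-positive 0<x (·-nonNegative n (proj₁ 0<x))

  -- The factor 12 from the differences is never cancelled: a negative sum would make 12 times the
  -- negated trace positive, and adding 12 times the nonnegative trace yields 0 < 0.
  spectrum-nonNegativeSum : ∀ {a b c d} (A : Matrix ℝ 4) → NonNegative A →
    HasSpectrum A (map ofReal (a ∷ b ∷ c ∷ d ∷ [])) → 0# ≤ d + a + (c + b)
  spectrum-nonNegativeSum {a} {b} {c} {d} A 0≤A χ≈ with ≤-or-> 0# (a + (b + (c + (d + 0#))))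
  ... | inj₁ 0≤sum = 0≤-resp (solve 4 (λ a b c d → a :+ (b :+ (c :+ (d :+ con (+ 0)))) :=
      d :+ a :+ (c :+ b)) R.refl a b c d) 0≤sum
  ... | inj₂ sum<0 = ⊥-elim (<-≰ 0<0 Order.refl)
    where
    tr : ℝ
    tr = A zero zero + (A (suc zero) (suc zero) + (A (suc (suc zero)) (suc (suc zero)) +
         (A (suc (suc (suc zero))) (suc (suc (suc zero))) + 0#)))
    0≤tr : 0# ≤ tr
    0≤tr = +-nonNegative (0≤A _ _) (+-nonNegative (0≤A _ _) (+-nonNegative (0≤A _ _)
      (+-nonNegative (0≤A _ _) Order.refl)))
    eq : 12 · - tr R.≈ 12 · - (a + (b + (c + (d + 0#))))
    eq = re≈ (χ.trace-from-roots (λ i j → ofReal (A i j)) (ofReal a) (ofReal b) (ofReal c)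
        (ofReal d)
      λ x → C.trans (C.sym (characteristicPolynomial≈ A x)) (χ≈ x))
    0<-sum : 0# < - (a + (b + (c + (d + 0#))))
    0<-sum = 0<-resp (R.+-identityˡ _) (x<y⇒0<y-x sum<0)
    0<0 : 0# < 0#
    0<0 = 0<-resp (solve 1 (λ t → 12 :× (:- t) :+ 12 :× t := con (+ 0)) R.refl tr)
      (+-positive (0<-resp (R.sym eq) (·-positive 11 0<-sum)) (·-nonNegative 12 0≤tr))

  -- Absolute values and spectral simplicity

  x≤∣x∣ : ∀ x → x ≤ ∣ ofReal x ∣
  -- The absolute value is the supremum of the y with y² at most x² + 0², and x is such a y.
  x≤∣x∣ x = proj₁ (proj₂ (supremum _ _ _)) x
    (Order.reflexive (solve 1 (λ x → x :* x := x :* x :+ con (+ 0) :* con (+ 0)) R.refl x))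

  -x≤∣x∣ : ∀ x → - x ≤ ∣ ofReal x ∣
  -x≤∣x∣ x = proj₁ (proj₂ (supremum _ _ _)) (- x)
    (Order.reflexive (solve 1 (λ x → :- x :* :- x := x :* x :+ con (+ 0) :* con (+ 0)) R.refl x))

  multiplicity-↭ : ∀ z {σ τ} → σ ↭ τ → multiplicity z σ ≡ multiplicity z τ
  multiplicity-↭ z σ↭τ = ↭.↭-length (↭.filter-↭ (z ≟ᶜ_) σ↭τ)

  -- If d were below r, nothing in the list would equal r and the multiplicity would be 0; if c = d,
  -- it would be at least 2. If d + a ≤ 0, then |a| = r, so simplicity forces a = r > 0,
  -- contradicting d + a ≤ 0.
  simple⇒dominant : ∀ {a b c d r} → a ≤ b → b ≤ c → c ≤ d → 0# < r → d ≤ r → ∣ ofReal a ∣ ≤ r →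
    multiplicity (ofReal r) (map ofReal (a ∷ b ∷ c ∷ d ∷ [])) ≡ 1 →
    (∣ ofReal a ∣ R.≈ r → ofReal a ≈ᶜ ofReal r) →
    c < d × 0# < d + a
  simple⇒dominant {a} {b} {c} {d} {r} a≤b b≤c c≤d 0<r d≤r ∣a∣≤r mult simple =
    (c≤d , c≉d) , ≰-< d+a≰0
    where
    P? = ofReal r ≟ᶜ_

    d≈r : d R.≈ r
    d≈r with d Order.≟ r
    ... | yes d≈r = d≈r
    ... | no  d≉r = contradiction (≡.trans (≡.sym (≡.cong length (filter-none P?
      (no-r (Order.trans a≤b (Order.trans b≤c c≤d)) ∷ no-r (Order.trans b≤c c≤d) ∷
       no-r c≤d ∷ no-r Order.refl ∷ [])))) mult) λ ()
      where
      no-r : ∀ {x} → x ≤ d → ¬ ofReal r ≈ᶜ ofReal x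
      no-r x≤d r≈x = d≉r (Order.antisym d≤r (Order.≤-respˡ-≈ (R.sym (re≈ r≈x)) x≤d))

    c≉d : ¬ c R.≈ d
    c≉d c≈d = ℕ.<⇒≱ {1} {2} (s≤s (s≤s z≤n)) (≡.subst₂ ℕ._≤_ two mult
      (ℕ.≤-trans (filter-∷-length P? (ofReal b) _) (filter-∷-length P? (ofReal a) _)))
      where
      two : length (filter P? (ofReal c ∷ ofReal d ∷ [])) ≡ 2
      two = ≡.cong length (≡.trans
        (filter-accept P? (ofReal-cong (R.sym (R.trans c≈d d≈r))))
        (≡.cong (ofReal c ∷_) (filter-accept P? (ofReal-cong (R.sym d≈r)))))

    d+a≰0 : ¬ d + a ≤ 0#
    d+a≰0 d+a≤0 = <-≰ (+-positive (0<-resp (R.sym d≈r) 0<r)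
        (proj₁ (0<-resp (R.sym (re≈ a≈r)) 0<r))) d+a≤0
      where
      r≤-a : r ≤ - a
      r≤-a = Order.≤-respˡ-≈ d≈r (0≤y-x⇒x≤y (0≤-resp (solve 2 (λ a d → con (+ 0) :- (d :+ a) :=
          :- a :- d) R.refl a d)
        (x≤y⇒0≤y-x d+a≤0)))
      a≈r : ofReal a ≈ᶜ ofReal r
      a≈r = simple (Order.antisym ∣a∣≤r (Order.trans r≤-a (-x≤∣x∣ a)))

  -- Powers and norms

  module RE = Exp R.commutativeSemiring
  open RE using () renaming (_^_ to _^ʳ_)

  ofReal-^ : ∀ x n → ofReal (x ^ʳ n) ≈ᶜ ofReal x ^ n
  ofReal-^ x zero    = C.refl
  ofReal-^ x (suc n) = C.trans (ofReal-* x (x ^ʳ n)) (C.*-congˡ {ofReal x} (ofReal-^ x n))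

  ^-positive : ∀ {x} n → 0# < x → 0# < x ^ʳ n
  ^-positive zero    0<x = 0<1
  ^-positive (suc n) 0<x = *-positive 0<x (^-positive n 0<x)

  *-mono-≤ : ∀ {w x y z} → 0# ≤ w → w ≤ x → 0# ≤ y → y ≤ z → w * y ≤ x * z
  *-mono-≤ {w} {x} {y} {z} 0≤w w≤x 0≤y y≤z = 0≤y-x⇒x≤y (0≤-resp
    (solve 4 (λ w x y z → (x :- w) :* y :+ x :* (z :- y) := x :* z :- w :* y) R.refl w x y z)
    (+-nonNegative (*-nonNegative (x≤y⇒0≤y-x w≤x) 0≤y)
                   (*-nonNegative (Order.trans 0≤w w≤x) (x≤y⇒0≤y-x y≤z))))

  ^-nonNegative : ∀ {x} n → 0# ≤ x → 0# ≤ x ^ʳ n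
  ^-nonNegative zero    0≤x = proj₁ 0<1
  ^-nonNegative (suc n) 0≤x = *-nonNegative 0≤x (^-nonNegative n 0≤x)

  ^-mono-≤ : ∀ {x y} n → 0# ≤ x → x ≤ y → x ^ʳ n ≤ y ^ʳ n
  ^-mono-≤ zero    0≤x x≤y = Order.refl
  ^-mono-≤ (suc n) 0≤x x≤y = *-mono-≤ 0≤x x≤y (^-nonNegative n 0≤x) (^-mono-≤ n 0≤x x≤y)

  -- The right side exceeds the left by y (yⁿ - xⁿ). This supplies the linear lower bound for the
  -- outer factor near its root.
  ^-growth : ∀ {x y} n → 0# < x → x ≤ y → (y - x) * x ^ʳ n ≤ y ^ʳ suc n - x ^ʳ suc n
  ^-growth {x} {y} n 0<x x≤y = 0≤y-x⇒x≤y (0≤-resp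
    (solve 4 (λ x y xⁿ yⁿ → y :* (yⁿ :- xⁿ) := y :* yⁿ :- x :* xⁿ :- (y :- x) :* xⁿ)
      R.refl x y (x ^ʳ n) (y ^ʳ n))
    (*-nonNegative (Order.trans (proj₁ 0<x) x≤y) (x≤y⇒0≤y-x (^-mono-≤ n (proj₁ 0<x) x≤y))))

  ^-mono-< : ∀ {x y} n → 0# ≤ x → x < y → x ^ʳ suc n < y ^ʳ suc n
  ^-mono-< {x} {y} n 0≤x x<y = 0<y-x⇒x<y (0<-resp
    (solve 4 (λ x y xⁿ yⁿ → (y :- x) :* yⁿ :+ x :* (yⁿ :- xⁿ) := y :* yⁿ :- x :* xⁿ)
      R.refl x y (x ^ʳ n) (y ^ʳ n))
    (+-positive (*-positive (x<y⇒0<y-x x<y) (^-positive n (≤-<-trans 0≤x x<y)))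
      (*-nonNegative 0≤x (x≤y⇒0≤y-x (^-mono-≤ n 0≤x (proj₁ x<y))))))

  -- Parity of the exponent is recorded by its effect on powers, the form in which it is applied
  -- both to `h` and to `p`.
  ^-parity : ∀ n → (∀ x → (- x) ^ʳ n R.≈ x ^ʳ n) ⊎ (∀ x → (- x) ^ʳ n R.≈ - (x ^ʳ n))
  ^-parity zero    = inj₁ λ _ → R.refl
  ^-parity (suc n) with ^-parity n
  ... | inj₁ even = inj₂ λ x → R.trans (R.*-congˡ (even x))
          (solve 2 (λ x y → :- x :* y := :- (x :* y)) R.refl x (x ^ʳ n))
  ... | inj₂ odd  = inj₁ λ x → R.trans (R.*-congˡ (odd x))
          (solve 2 (λ x y → :- x :* :- y := x :* y) R.refl x (x ^ʳ n))

  -- The radicand of `∣ z ∣`. It is multiplicative by a ring identity, so products and powers are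
  -- estimated without square roots.
  norm² : ℂ → ℝ
  norm² z = re z * re z + im z * im z

  norm²-cong : ∀ {z w} → z ≈ᶜ w → norm² z R.≈ norm² w
  norm²-cong z≈w = R.+-cong (R.*-cong (re≈ z≈w) (re≈ z≈w)) (R.*-cong (im≈ z≈w) (im≈ z≈w))

  norm²-* : ∀ z w → norm² (z *ᶜ w) R.≈ norm² z * norm² w
  norm²-* z w = solve 4 (λ a b c d →
    (a :* c :- b :* d) :* (a :* c :- b :* d) :+ (a :* d :+ b :* c) :* (a :* d :+ b :* c) :=
    (a :* a :+ b :* b) :* (c :* c :+ d :* d)) R.refl (re z) (im z) (re w) (im w)

  norm²-ofReal : ∀ x → norm² (ofReal x) R.≈ x * x
  norm²-ofReal = solve 1 (λ x → x :* x :+ con (+ 0) :* con (+ 0) := x :* x) R.refl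

  norm²-^ : ∀ z n → norm² (z ^ n) R.≈ norm² z ^ʳ n
  norm²-^ z zero    = R.trans (norm²-ofReal 1#) (R.*-identityˡ 1#)
  norm²-^ z (suc n) = R.trans (norm²-* z (z ^ n)) (R.*-congˡ (norm²-^ z n))

  norm²-nonNegative : ∀ z → 0# ≤ norm² z
  norm²-nonNegative z = +-nonNegative (x²-nonNegative (re z)) (x²-nonNegative (im z))

  ∣z∣<1⇒norm²<1 : ∀ z → ∣ z ∣ < 1# → norm² z < 1#
  ∣z∣<1⇒norm²<1 z ∣z∣<1 = ≰-< λ 1≤norm² → <-≰ ∣z∣<1
    (proj₁ (proj₂ (supremum _ _ _)) 1# (Order.≤-respˡ-≈ (R.sym (R.*-identityˡ 1#)) 1≤norm²))

  x²≤y²⇒x≤y : ∀ {x y} → 0# < y → x * x ≤ y * y → x ≤ y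
  x²≤y²⇒x≤y {x} {y} 0<y x²≤y² with ≤-or-> x y
  ... | inj₁ x≤y = x≤y
  ... | inj₂ y<x = contradiction x²≤y² (<-≰ (0<y-x⇒x<y (0<-resp
    (solve 2 (λ x y → (x :- y) :* (y :+ x) := x :* x :- y :* y) R.refl x y)
    (*-positive (x<y⇒0<y-x y<x) (+-positive 0<y (Order.trans (proj₁ 0<y) (proj₁ y<x)))))))

  x²<y²⇒x<y : ∀ {x y} → 0# < y → x * x < y * y → x < y
  x²<y²⇒x<y 0<y x²<y² = x²≤y²⇒x≤y 0<y (proj₁ x²<y²) , λ x≈y → proj₂ x²<y² (R.*-cong x≈y x≈y)

  x²+y²≈0⇒x≈0 : ∀ {x y} → x * x + y * y R.≈ 0# → x R.≈ 0#
  x²+y²≈0⇒x≈0 {x} {y} eq with x Order.≟ 0#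
  ... | yes x≈0 = x≈0
  ... | no  x≉0 = contradiction (Order.reflexive eq) (<-≰ (+-positive
    (x²-nonNegative x , λ 0≈x² → [ x≉0 , x≉0 ]′ (x*y≈0⇒x≈0∨y≈0 (R.sym 0≈x²))) (x²-nonNegative y)))

  -- To be used with R = ρ^h and the points (z ρ)^h: in the variable u = t^h the inner factors of a
  -- Frobenius factorisation are linear, with roots in the open disc of radius R.
  module InnerFactors {R : ℝ} (0<R : 0# < R) where
    Inner : ℂ → Set
    Inner w = norm² w < R * R

    inner : ℝ → List ℂ → ℂ
    inner u ws = productᶜ (map (λ w → ofReal u -ᶜ w) ws)

    -- On the ray u ≥ R the distance to an inner point w is at least R − re w.
    norm²-inner-bound : ∀ {ws} → All Inner ws →
      ∃ λ δ → 0# < δ × ∀ {u} → R ≤ u → δ ≤ norm² (inner u ws)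
    norm²-inner-bound [] = 1# , 0<1 , λ _ → Order.reflexive (R.sym (R.trans (norm²-ofReal 1#)
        (R.*-identityˡ 1#)))
    norm²-inner-bound {w ∷ ws} (w-inner ∷ ws-inner) =
      let δ , 0<δ , bound = norm²-inner-bound ws-inner in
      (R - re w) * (R - re w) * δ , *-positive (*-positive 0<R-w 0<R-w) 0<δ , λ {u} R≤u →
      Order.≤-respʳ-≈ (R.sym (norm²-* (ofReal u -ᶜ w) (inner u ws)))
        (*-mono-≤ (x²-nonNegative (R - re w)) (first R≤u) (proj₁ 0<δ) (bound R≤u))
      where
      0<R-w : 0# < R - re w
      0<R-w = x<y⇒0<y-x (x²<y²⇒x<y 0<R (≤-<-trans
        (0≤y-x⇒x≤y (0≤-resp (solve 2 (λ a b → b :* b := a :* a :+ b :* b :- a :* a)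
            R.refl (re w) (im w))
          (x²-nonNegative (im w)))) w-inner))

      first : ∀ {u} → R ≤ u → (R - re w) * (R - re w) ≤ norm² (ofReal u -ᶜ w)
      first {u} R≤u = Order.trans
        (*-mono-≤ (proj₁ 0<R-w) R-w≤u-w (proj₁ 0<R-w) R-w≤u-w)
        (0≤y-x⇒x≤y (0≤-resp (solve 2 (λ a b → b := a :+ b :- a) R.refl _ _)
          (x²-nonNegative (im (ofReal u -ᶜ w)))))
        where
        R-w≤u-w : R - re w ≤ u - re w
        R-w≤u-w = +-monoˡ-≤ (- re w) R≤u

    -- A vanishing factor would put an inner point on the circle of radius R. The condition on u
    -- covers both R and -R; the latter is (-ρ)^h for odd h.
    norm²-inner≉0 : ∀ {ws} → All Inner ws → ∀ {u} → u * u R.≈ R * R → ¬ norm² (inner u ws) R.≈ 0#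
    norm²-inner≉0 []                         u²≈R² eq =
      0≉1 (R.sym (R.trans (R.sym (R.trans (norm²-ofReal 1#) (R.*-identityˡ 1#))) eq))
    norm²-inner≉0 {w ∷ ws} (w-inner ∷ ws-inner) {u} u²≈R² eq =
      [ w≉u , norm²-inner≉0 ws-inner u²≈R² ]′
        (x*y≈0⇒x≈0∨y≈0 (R.trans (R.sym (norm²-* (ofReal u -ᶜ w) (inner u ws))) eq))
      where
      open SetoidReasoning R.setoid
      x-y≈0⇒y≈x : ∀ {x y} → x - y R.≈ 0# → y R.≈ x
      x-y≈0⇒y≈x {x} {y} eq = begin
        y            ≈⟨ solve 2 (λ x y → y := x :- (x :- y)) R.refl x y ⟩
        x - (x - y)  ≈⟨ R.+-congˡ (R.-‿cong eq) ⟩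
        x - 0#       ≈⟨ solve 1 (λ x → x :- con (+ 0) := x) R.refl x ⟩
        x            ∎
      w≉u : ¬ norm² (ofReal u -ᶜ w) R.≈ 0#
      w≉u eq = proj₂ w-inner (begin
        norm² w            ≈⟨ norm²-cong (x-y≈0⇒y≈x (x²+y²≈0⇒x≈0 eq) ,
                                          x-y≈0⇒y≈x (x²+y²≈0⇒x≈0 (R.trans (R.+-comm _ _) eq))) ⟩
        norm² (ofReal u)   ≈⟨ norm²-ofReal u ⟩
        u * u              ≈⟨ u²≈R² ⟩
        R * R              ∎)

  -- Lists with Frobenius structure

  realProduct : List ℝ → ℝ → ℝ
  realProduct []      t = 1#
  realProduct (x ∷ σ) t = (t - x) * realProduct σ t

  polynomialWithRoots-ofReal : ∀ σ t →
    polynomialWithRoots (map ofReal σ) (ofReal t) ≈ᶜ ofReal (realProduct σ t)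
  polynomialWithRoots-ofReal []      t = C.refl
  polynomialWithRoots-ofReal (x ∷ σ) t = C.trans
    (C.*-cong (C.sym (ofReal-sub t x)) (polynomialWithRoots-ofReal σ t))
    (C.sym (ofReal-* (t - x) (realProduct σ t)))

  -- With c = d = r and t = r + η, the square of f(t) is η⁴ (t - a)² (t - b)², at most η⁴ M. The
  -- assumed bound makes it at least η² κ, which is impossible once η² M < κ.
  no-double-root : ∀ {a b c d r κ} → 0# < r → - r ≤ a → a ≤ r → - r ≤ b → b ≤ r →
    c R.≈ r → d R.≈ r → 0# < κ →
    (let f = realProduct (a ∷ b ∷ c ∷ d ∷ []) in
      ∀ {t} → r < t → (t - r) * (t - r) * κ ≤ f t * f t) → ⊥
  no-double-root {a} {b} {c} {d} {r} {κ} 0<r -r≤a a≤r -r≤b b≤r c≈r d≈r 0<κ bound =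
    <-≰ (0<y-x⇒x<y (0<-resp
      (solve 3 (λ η κ M → η :* η :* (κ :- η :* η :* M) := η :* η :* κ :- η :* η :* (η :* η) :* M)
          R.refl η κ M)
      (*-positive (*-positive 0<η 0<η) 0<κ-η²M)))
      (Order.trans (Order.≤-respˡ-≈ (R.*-congʳ (R.*-cong t-r≈η t-r≈η)) (bound r<t))
        (Order.≤-respˡ-≈ (R.sym f²≈) (0≤y-x⇒x≤y (0≤-resp (solve 3 (λ x y z → x :* (y :- z) :=
            x :* y :- x :* z) R.refl _ _ _)
          (*-nonNegative (proj₁ (*-positive (*-positive 0<η 0<η) (*-positive 0<η 0<η)))
              (x≤y⇒0≤y-x Q²≤M))))))
    where
    open SetoidReasoning R.setoid
    3r M D : ℝ
    3r = r + r + r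
    M  = 3r * 3r * (3r * 3r)
    -- The denominator of η = r κ / D. Since κ ≤ D, η ≤ r, so t - a and t - b are at most 3r. With X
    -- = r² M, the bound η² M < κ amounts to D² - κ X = κ² + κ X + X² > 0.
    D  = κ + r * r * M

    0<3r : 0# < 3r
    0<3r = +-positive (+-positive 0<r (proj₁ 0<r)) (proj₁ 0<r)

    0<r²M : 0# < r * r * M
    0<r²M = *-positive (*-positive 0<r 0<r) (*-positive (*-positive 0<3r 0<3r)
        (*-positive 0<3r 0<3r))

    0<D : 0# < D
    0<D = +-positive 0<κ (proj₁ 0<r²M)

    D⁻¹ : ℝ
    D⁻¹ = proj₁ (inverse D (proj₂ 0<D ∘ R.sym))

    DD⁻¹≈1 : D * D⁻¹ R.≈ 1#
    DD⁻¹≈1 = proj₂ (inverse D (proj₂ 0<D ∘ R.sym))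

    0<D⁻¹ : 0# < D⁻¹
    0<D⁻¹ = ≰-< λ D⁻¹≤0 → <-≰ 0<1 (Order.≤-respˡ-≈ DD⁻¹≈1 (0≤y-x⇒x≤y (0≤-resp
      (solve 2 (λ x y → x :* :- y := con (+ 0) :- x :* y) R.refl D D⁻¹)
      (*-nonNegative (proj₁ 0<D) (x≤0⇒0≤-x D⁻¹≤0)))))

    -- Chosen so that η ≤ r and η² M < κ.
    η t Q : ℝ
    η = r * κ * D⁻¹
    t = r + η
    Q = (t - a) * (t - b)

    0<η : 0# < η
    0<η = *-positive (*-positive 0<r 0<κ) 0<D⁻¹

    t-r≈η : t - r R.≈ η
    t-r≈η = solve 2 (λ r η → r :+ η :- r := η) R.refl r η

    r<t : r < t
    r<t = 0<y-x⇒x<y (0<-resp (R.sym t-r≈η) 0<η)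

    0≤r-η : 0# ≤ r - η
    0≤r-η = 0≤-resp (begin
      r * (r * r * M) * D⁻¹   ≈⟨ solve 4 (λ r κ x i → r :* x :* i :=
          r :* ((κ :+ x) :* i) :- r :* κ :* i) R.refl r κ (r * r * M) D⁻¹ ⟩
      r * (D * D⁻¹) - η       ≈⟨ R.+-congʳ (R.*-congˡ DD⁻¹≈1) ⟩
      r * 1# - η              ≈⟨ R.+-congʳ (R.*-identityʳ r) ⟩
      r - η                   ∎) (proj₁ (*-positive (*-positive 0<r 0<r²M) 0<D⁻¹))

    0<κ-η²M : 0# < κ - η * η * M
    0<κ-η²M = 0<-resp (begin
      D⁻¹ * D⁻¹ * (κ * (κ * κ + (κ * (r * r * M) + r * r * M * (r * r * M))))
        ≈⟨ solve 4 (λ r κ m i →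
             i :* i :* (κ :* (κ :* κ :+ (κ :* (r :* r :* m) :+ r :* r :* m :* (r :* r :* m)))) :=
             κ :* ((κ :+ r :* r :* m) :* i) :* ((κ :+ r :* r :* m) :* i) :- (r :* κ :* i) :*
                 (r :* κ :* i) :* m)
             R.refl r κ M D⁻¹ ⟩
      κ * (D * D⁻¹) * (D * D⁻¹) - η * η * M  ≈⟨ R.+-congʳ (R.*-cong (R.*-congˡ DD⁻¹≈1) DD⁻¹≈1) ⟩
      κ * 1# * 1# - η * η * M                ≈⟨ R.+-congʳ (R.trans (R.*-identityʳ _)
          (R.*-identityʳ κ)) ⟩
      κ - η * η * M                          ∎)
      (*-positive (*-positive 0<D⁻¹ 0<D⁻¹) (*-positive 0<κ (+-positive (*-positive 0<κ 0<κ)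
        (proj₁ (+-positive (*-positive 0<κ 0<r²M) (proj₁ (*-positive 0<r²M 0<r²M)))))))

    0≤t-x : ∀ {x} → x ≤ r → 0# ≤ t - x
    0≤t-x {x} x≤r = 0≤-resp (solve 3 (λ r η x → η :+ (r :- x) := r :+ η :- x) R.refl r η x)
      (+-nonNegative (proj₁ 0<η) (x≤y⇒0≤y-x x≤r))

    t-x≤3r : ∀ {x} → - r ≤ x → t - x ≤ 3r
    t-x≤3r {x} -r≤x = 0≤y-x⇒x≤y (0≤-resp
      (solve 3 (λ r η x → r :- η :+ (x :- :- r) := r :+ r :+ r :- (r :+ η :- x)) R.refl r η x)
      (+-nonNegative 0≤r-η (x≤y⇒0≤y-x -r≤x)))

    0≤Q : 0# ≤ Q
    0≤Q = *-nonNegative (0≤t-x a≤r) (0≤t-x b≤r)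

    Q≤9r² : Q ≤ 3r * 3r
    Q≤9r² = *-mono-≤ (0≤t-x a≤r) (t-x≤3r -r≤a) (0≤t-x b≤r) (t-x≤3r -r≤b)

    Q²≤M : Q * Q ≤ M
    Q²≤M = *-mono-≤ 0≤Q Q≤9r² 0≤Q Q≤9r²

    f≈ : realProduct (a ∷ b ∷ c ∷ d ∷ []) t R.≈ Q * (η * η)
    f≈ = begin
      (t - a) * ((t - b) * ((t - c) * ((t - d) * 1#)))
        ≈⟨ R.*-congˡ (R.*-congˡ (R.*-cong (factor c≈r) (R.*-congʳ (factor d≈r)))) ⟩
      (t - a) * ((t - b) * (η * (η * 1#)))
        ≈⟨ solve 3 (λ x y η → x :* (y :* (η :* (η :* con (+ 1)))) := x :* y :* (η :* η))
            R.refl (t - a) (t - b) η ⟩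
      Q * (η * η) ∎
      where
      factor : ∀ {x} → x R.≈ r → t - x R.≈ η
      factor x≈r = R.trans (R.+-congˡ (R.-‿cong x≈r)) t-r≈η

    f²≈ : realProduct (a ∷ b ∷ c ∷ d ∷ []) t * realProduct (a ∷ b ∷ c ∷ d ∷ []) t R.≈
          η * η * (η * η) * (Q * Q)
    f²≈ = R.trans (R.*-cong f≈ f≈) (solve 2 (λ q η → q :* (η :* η) :* (q :* (η :* η)) :=
        η :* η :* (η :* η) :* (q :* q)) R.refl Q η)

  open Mult R.semiring using (×-congʳ; ×-assoc-*)

  0<x∧xy≈0⇒y≈0 : ∀ {x y} → 0# < x → x * y R.≈ 0# → y R.≈ 0#
  0<x∧xy≈0⇒y≈0 (_ , 0≉x) xy≈0 = [ (λ x≈0 → contradiction (R.sym x≈0) 0≉x) , (λ y≈0 → y≈0) ]′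
      (x*y≈0⇒x≈0∨y≈0 xy≈0)

  n·x≈0⇒x≈0 : ∀ n {x} → suc n · x R.≈ 0# → x R.≈ 0#
  n·x≈0⇒x≈0 n {x} nx≈0 = 0<x∧xy≈0⇒y≈0 (·-positive n 0<1) (R.trans (×-assoc-* (suc n) 1# x)
    (R.trans (×-congʳ (suc n) (R.*-identityˡ x)) nx≈0))

  -- With outer roots ±r, evaluating at 2r and 3r separates the even from the odd case.
  parity⇒b+c≈0 : ∀ {a b c d r} → 0# < r → a R.≈ - r → d R.≈ r →
    (let f = realProduct (a ∷ b ∷ c ∷ d ∷ []) in
      (∀ t → f (- t) R.≈ f t) ⊎ (∀ t → f (- t) R.≈ - f t)) →
    b + c R.≈ 0#
  parity⇒b+c≈0 {a} {b} {c} {d} {r} 0<r a≈-r d≈r parity = [ even , odd ]′ parity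
    where
    open SetoidReasoning R.setoid
    f g : ℝ → ℝ
    f = realProduct (a ∷ b ∷ c ∷ d ∷ [])
    g = realProduct (- r ∷ b ∷ c ∷ r ∷ [])

    f≈g : ∀ t → f t R.≈ g t
    f≈g t = R.*-cong (R.+-congˡ (R.-‿cong a≈-r))
      (R.*-congˡ (R.*-congˡ (R.*-congʳ (R.+-congˡ (R.-‿cong d≈r)))))

    0<r² : 0# < r * r
    0<r² = *-positive 0<r 0<r

    gP : ∀ {n} → (r b c t : Polynomial n) → Polynomial n
    gP r b c t = (t :- :- r) :* ((t :- b) :* ((t :- c) :* ((t :- r) :* con (+ 1))))

    even : (∀ t → f (- t) R.≈ f t) → b + c R.≈ 0#
    even f-even = 0<x∧xy≈0⇒y≈0 (*-positive 0<r² 0<r) (n·x≈0⇒x≈0 11 (begin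
      12 · (r * r * r * (b + c))
        ≈⟨ solve 3 (λ r b c → 12 :× (r :* r :* r :* (b :+ c)) :=
             gP r b c (:- (r :+ r)) :- gP r b c (r :+ r)) R.refl r b c ⟩
      g (- (r + r)) - g (r + r)
        ≈⟨ R.+-cong (f≈g _) (R.-‿cong (f≈g _)) ⟨
      f (- (r + r)) - f (r + r)
        ≈⟨ R.+-congʳ (f-even (r + r)) ⟩
      f (r + r) - f (r + r)
        ≈⟨ R.-‿inverseʳ _ ⟩
      0# ∎))

    odd : (∀ t → f (- t) R.≈ - f t) → b + c R.≈ 0#
    odd f-odd = contradiction (n·x≈0⇒x≈0 239 (begin
      -- Here g(-t) + g(t) = 2 (t² - r²)(t² + bc). At 3r and 2r the terms in bc are 16 r² bc and 6
      -- r² bc, so the weights 3 and 8 cancel them and leave 3 · 144 - 8 · 24 = 240 times r⁴.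
      240 · (r * r * (r * r))
        ≈⟨ solve 3 (λ r b c → 240 :× (r :* r :* (r :* r)) :=
             3 :× (gP r b c (:- (r :+ r :+ r)) :+ gP r b c (r :+ r :+ r)) :-
             8 :× (gP r b c (:- (r :+ r)) :+ gP r b c (r :+ r))) R.refl r b c ⟩
      3 · (g (- (r + r + r)) + g (r + r + r)) - 8 · (g (- (r + r)) + g (r + r))
        ≈⟨ R.+-cong (×-congʳ 3 (vanish (r + r + r))) (R.-‿cong (×-congʳ 8 (vanish (r + r)))) ⟩
      3 · 0# - 8 · 0#
        ≈⟨ solve 0 (3 :× con (+ 0) :- 8 :× con (+ 0) := con (+ 0)) R.refl ⟩
      0# ∎)) (proj₂ (*-positive 0<r² 0<r²) ∘ R.sym)
      where
      vanish : ∀ t → g (- t) + g t R.≈ 0#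
      vanish t = R.trans (R.+-cong (R.sym (f≈g _)) (R.sym (f≈g _)))
        (R.trans (R.+-congʳ (f-odd t)) (R.-‿inverseˡ (f t)))

  -- Consequences of a Frobenius factorisation

  module _ {r : ℝ} (0<r : 0# < r) (p n : ℕ) {zs : List ℂ} (zs<1 : All (λ z → ∣ z ∣ < 1#) zs) where
    h : ℕ
    h = suc n

    open InnerFactors (^-positive h 0<r)

    innerPower : ℂ → ℂ
    innerPower z = (z *ᶜ ofReal r) ^ h

    ws : List ℂ
    ws = map innerPower zs

    innerPower-inner : ∀ {z} → ∣ z ∣ < 1# → Inner (innerPower z)
    innerPower-inner {z} ∣z∣<1 = ≤-<-trans
      (Order.reflexive (R.trans (norm²-^ (z *ᶜ ofReal r) h) (RE.^-congˡ h (norm²-* z (ofReal r)))))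
      (<-≤-trans (^-mono-< n (*-nonNegative (norm²-nonNegative z) (norm²-nonNegative (ofReal r)))
                   (0<y-x⇒x<y (0<-resp
                     (solve 3 (λ x r n → (con (+ 1) :- x) :* (r :* r) :+ x :* (r :* r :- n) :=
                         r :* r :- x :* n)
                       R.refl (norm² z) r (norm² (ofReal r)))
                     (+-positive (*-positive (x<y⇒0<y-x (∣z∣<1⇒norm²<1 z ∣z∣<1))
                         (*-positive 0<r 0<r))
                       (*-nonNegative (norm²-nonNegative z) (x≤y⇒0≤y-x
                           (Order.reflexive (norm²-ofReal r))))))))
                 (Order.reflexive (RE.^-distrib-* r r h)))

    ws-inner : All Inner ws
    ws-inner = All.map⁺ (All.map innerPower-inner zs<1)

    factorised : ℂ → ℂ
    factorised x = x ^ p *ᶜ (x ^ h -ᶜ ofReal r ^ h) *ᶜ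
                   productᶜ (map (λ z → x ^ h -ᶜ (z *ᶜ ofReal r) ^ h) zs)

    outer : ℝ → ℝ
    outer t = t ^ʳ p * (t ^ʳ h - r ^ʳ h)

    inner-power : ∀ t zs → productᶜ (map (λ z → ofReal t ^ h -ᶜ innerPower z) zs) ≈ᶜ
                           inner (t ^ʳ h) (map innerPower zs)
    inner-power t []       = C.refl
    inner-power t (z ∷ zs) = C.*-cong (C.+-congʳ (C.sym (ofReal-^ t h))) (inner-power t zs)

    factorised-ofReal : ∀ t → factorised (ofReal t) ≈ᶜ ofReal (outer t) *ᶜ inner (t ^ʳ h) ws
    factorised-ofReal t = C.*-cong
      (C.sym (C.trans (ofReal-* (t ^ʳ p) (t ^ʳ h - r ^ʳ h)) (C.*-cong (ofReal-^ t p)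
        (C.trans (ofReal-sub (t ^ʳ h) (r ^ʳ h))
          (C.+-cong (ofReal-^ t h) (C.-‿cong (ofReal-^ r h)))))))
      (inner-power t zs)

    inner-cong : ∀ {u v} → u R.≈ v → ∀ ws → inner u ws ≈ᶜ inner v ws
    inner-cong u≈v []       = C.refl
    inner-cong u≈v (w ∷ ws) = C.*-cong (C.+-congʳ (ofReal-cong u≈v)) (inner-cong u≈v ws)

    module _ {f : ℝ → ℝ} (f≈ : ∀ t → ofReal (f t) ≈ᶜ factorised (ofReal t)) where
      f≈outer*inner : ∀ t → ofReal (f t) ≈ᶜ ofReal (outer t) *ᶜ inner (t ^ʳ h) ws
      f≈outer*inner t = C.trans (f≈ t) (factorised-ofReal t)

      f²≈ : ∀ t → f t * f t R.≈ outer t * outer t * norm² (inner (t ^ʳ h) ws)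
      f²≈ t = begin
        f t * f t                                            ≈⟨ norm²-ofReal (f t) ⟨
        norm² (ofReal (f t))                                 ≈⟨ norm²-cong (f≈outer*inner t) ⟩
        norm² (ofReal (outer t) *ᶜ inner (t ^ʳ h) ws)
          ≈⟨ norm²-* (ofReal (outer t)) (inner (t ^ʳ h) ws) ⟩
        norm² (ofReal (outer t)) * norm² (inner (t ^ʳ h) ws) ≈⟨ R.*-congʳ (norm²-ofReal (outer t)) ⟩
        outer t * outer t * norm² (inner (t ^ʳ h) ws)        ∎
        where open SetoidReasoning R.setoid

      -- For t > r the outer factor is at least (t - r) r^p r^n by `^-growth`, and the inner factors
      -- have squared modulus at least δ. Squaring removes the sign of f.
      simple-root-bound : ∃ λ κ → 0# < κ × ∀ {t} → r < t → (t - r) * (t - r) * κ ≤ f t * f t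
      simple-root-bound = let δ , 0<δ , δ≤norm² = norm²-inner-bound ws-inner in
        s * s * δ , *-positive (*-positive 0<s 0<s) 0<δ , λ {t} r<t →
        let r≤t     = proj₁ r<t
            0≤t-r   = x≤y⇒0≤y-x r≤t
            0≤rᵖ    = proj₁ (^-positive p 0<r)
            0≤t-r*  = *-nonNegative 0≤t-r (proj₁ (^-positive n 0<r))
            0≤lower = *-nonNegative 0≤rᵖ 0≤t-r*
            lower≤outer = *-mono-≤ 0≤rᵖ (^-mono-≤ p (proj₁ 0<r) r≤t) 0≤t-r* (^-growth n 0<r r≤t)
        in Order.≤-respˡ-≈
          (solve 4 (λ e a b δ → (a :* (e :* b)) :* (a :* (e :* b)) :* δ :=
              e :* e :* ((a :* b) :* (a :* b) :* δ))
            R.refl (t - r) (r ^ʳ p) (r ^ʳ n) δ)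
          (Order.≤-respʳ-≈ (R.sym (f²≈ t))
            (*-mono-≤ (*-nonNegative 0≤lower 0≤lower)
                (*-mono-≤ 0≤lower lower≤outer 0≤lower lower≤outer)
              (proj₁ 0<δ) (δ≤norm² (^-mono-≤ h (proj₁ 0<r) r≤t))))
        where
        s : ℝ
        s = r ^ʳ p * r ^ʳ n
        0<s : 0# < s
        0<s = *-positive (^-positive p 0<r) (^-positive n 0<r)

      ≉0⇒power≉0 : ∀ {x} m → ¬ x R.≈ 0# → ¬ x ^ʳ m R.≈ 0#
      ≉0⇒power≉0 zero    x≉0 = 0≉1 ∘ R.sym
      ≉0⇒power≉0 (suc m) x≉0 = [ x≉0 , ≉0⇒power≉0 m x≉0 ]′ ∘ x*y≈0⇒x≈0∨y≈0

      -- For odd h the outer factor at -r is (-r)^p times -2 r^h, which is nonzero, and the inner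
      -- factors do not vanish at u = -r^h; then f(-r) could not be 0.
      root-at-−r⇒even : f (- r) R.≈ 0# → ∀ x → (- x) ^ʳ h R.≈ x ^ʳ h
      root-at-−r⇒even f[-r]≈0 = [ (λ even → even) , ⊥-elim ∘ ¬odd ]′ (^-parity h)
        where
        0<rʰ : 0# < r ^ʳ h
        0<rʰ = ^-positive h 0<r

        -r≉0 : ¬ - r R.≈ 0#
        -r≉0 -r≈0 = proj₂ 0<r (R.sym (R.trans (solve 1 (λ r → r := con (+ 0) :- (:- r)) R.refl r)
          (R.trans (R.+-congˡ (R.-‿cong -r≈0)) (R.-‿inverseʳ 0#))))

        ¬odd : ¬ (∀ x → (- x) ^ʳ h R.≈ - (x ^ʳ h))
        ¬odd odd = [ [ outer≉0 , outer≉0 ]′ ∘ x*y≈0⇒x≈0∨y≈0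
                   , norm²-inner≉0 ws-inner (R.trans (R.*-cong (odd r) (odd r))
                       (solve 1 (λ x → :- x :* :- x := x :* x) R.refl (r ^ʳ h))) ]′
          (x*y≈0⇒x≈0∨y≈0 (R.trans (R.sym (f²≈ (- r)))
            (R.trans (R.*-congʳ f[-r]≈0) (R.zeroˡ _))))
          where
          outer≉0 : ¬ outer (- r) R.≈ 0#
          outer≉0 = [ ≉0⇒power≉0 p -r≉0 , (λ eq → proj₂ (+-positive 0<rʰ (proj₁ 0<rʰ)) (R.sym
            (R.trans (solve 1 (λ x → x :+ x := :- (:- x :- x)) R.refl (r ^ʳ h))
              (R.trans (R.-‿cong (R.trans (R.+-congʳ (R.sym (odd r))) eq))
                (solve 0 (:- con (+ 0) := con (+ 0)) R.refl))))) ]′ ∘ x*y≈0⇒x≈0∨y≈0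

      -- For even h every factor except t^p depends on t only through t^h, which is unchanged by the
      -- sign of t. So f has the parity of p.
      even⇒f-parity : (∀ x → (- x) ^ʳ h R.≈ x ^ʳ h) →
        (∀ t → f (- t) R.≈ f t) ⊎ (∀ t → f (- t) R.≈ - f t)
      even⇒f-parity even = [ inj₁ ∘ f-even , inj₂ ∘ f-odd ]′ (^-parity p)
        where
        f[-t]≈ : ∀ t → ofReal (f (- t)) ≈ᶜ ofReal (outer (- t)) *ᶜ inner (t ^ʳ h) ws
        f[-t]≈ t = C.trans (f≈outer*inner (- t))
          (C.*-congˡ {ofReal (outer (- t))} (inner-cong (even t) ws))

        f-even : (∀ t → (- t) ^ʳ p R.≈ t ^ʳ p) → ∀ t → f (- t) R.≈ f t
        f-even p-even t = re≈ (C.trans (f[-t]≈ t) (C.trans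
          (C.*-congʳ {inner (t ^ʳ h) ws} (ofReal-cong (R.*-cong (p-even t) (R.+-congʳ (even t)))))
          (C.sym (f≈outer*inner t))))

        f-odd : (∀ t → (- t) ^ʳ p R.≈ - (t ^ʳ p)) → ∀ t → f (- t) R.≈ - f t
        f-odd p-odd t = re≈ (C.trans (f[-t]≈ t) (C.trans
          (C.*-congʳ {inner (t ^ʳ h) ws} (C.trans (ofReal-cong (R.trans
            (R.*-cong (p-odd t) (R.+-congʳ (even t)))
            (solve 2 (λ x y → :- x :* y := :- (x :* y)) R.refl (t ^ʳ p) (t ^ʳ h - r ^ʳ h))))
            (ofReal-neg (outer t))))
          (C.trans (C.sym (-‿distribˡ-* (ofReal (outer t)) (inner (t ^ʳ h) ws)))
            (C.-‿cong (C.sym (f≈outer*inner t))))))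
          where open Algebra.Properties.Ring C.ring using (-‿distribˡ-*)

  BalancedPairs : ℝ → ℝ → ℝ → ℝ → Set
  BalancedPairs a b c d = d + a R.≈ 0# × b + c R.≈ 0#

  frobenius⇒balanced : ∀ {σ a b c d} → 0# < ρ (map ofReal σ) → σ ↭ a ∷ b ∷ c ∷ d ∷ [] →
    All (λ x → - ρ (map ofReal σ) ≤ x × x ≤ ρ (map ofReal σ)) (a ∷ b ∷ c ∷ d ∷ []) →
    d R.≈ ρ (map ofReal σ) → c ≤ d → ¬ (c < d × 0# < d + a) →
    FrobeniusStructure (map ofReal σ) → c < d × BalancedPairs a b c d
  frobenius⇒balanced {σ} {a} {b} {c} {d} 0<ρ σ↭
    ((-ρ≤a , a≤ρ) ∷ (-ρ≤b , b≤ρ) ∷ _) d≈ρ c≤d ¬dominant F =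
    analyse (FrobeniusStructure.h F) (FrobeniusStructure.1<h F) (FrobeniusStructure.factorisation F)
    where
    open FrobeniusStructure F using (p; zs; zs<1)
    r : ℝ
    r = ρ (map ofReal σ)

    f : ℝ → ℝ
    f = realProduct (a ∷ b ∷ c ∷ d ∷ [])

    -- The exponent is abstracted from the record so that it can be matched as `suc n`; `1 < h`
    -- excludes zero.
    analyse : ∀ h → 1 ℕ.< h → (∀ x → polynomialWithRoots (map ofReal σ) x ≈ᶜ
      x ^ p *ᶜ (x ^ h -ᶜ ofReal r ^ h) *ᶜ productᶜ (map (λ z → x ^ h -ᶜ (z *ᶜ ofReal r) ^ h) zs)) →
      c < d × BalancedPairs a b c d
    analyse (suc n) _ factorisation = c<d , d+a≈0 , parity⇒b+c≈0 0<ρ a≈-ρ d≈ρ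
      (even⇒f-parity 0<ρ p n zs<1 f≈ (root-at-−r⇒even 0<ρ p n zs<1 f≈ f[-r]≈0))
      where
      f≈ : ∀ t → ofReal (f t) ≈ᶜ factorised 0<ρ p n zs<1 (ofReal t)
      f≈ t = C.trans (C.sym (polynomialWithRoots-ofReal (a ∷ b ∷ c ∷ d ∷ []) t))
        (C.trans (C.sym (polynomialWithRoots-↭ σ↭ (ofReal t))) (factorisation (ofReal t)))

      c<d : c < d
      c<d = c≤d , λ c≈d → let κ , 0<κ , bound = simple-root-bound 0<ρ p n zs<1 f≈ in
        no-double-root 0<ρ -ρ≤a a≤ρ -ρ≤b b≤ρ (R.trans c≈d d≈ρ) d≈ρ 0<κ bound

      -- At most 0 because c < d and the dominant case is excluded; at least 0 because a ≥ -ρ and d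
      -- = ρ.
      d+a≈0 : d + a R.≈ 0#
      d+a≈0 = Order.antisym
        ([ (λ ≤0 → ≤0) , (λ 0<d+a → contradiction (c<d , 0<d+a) ¬dominant) ]′ (≤-or-> (d + a) 0#))
        (0≤-resp (R.trans (solve 2 (λ a r → a :- :- r := r :+ a) R.refl a r)
          (R.+-congʳ (R.sym d≈ρ)))
          (x≤y⇒0≤y-x -ρ≤a))

      a≈-ρ : a R.≈ - r
      a≈-ρ = R.trans (solve 2 (λ a d → a := d :+ a :- d) R.refl a d)
        (R.trans (R.+-cong d+a≈0 (R.-‿cong d≈ρ)) (R.+-identityˡ (- r)))

      f[-r]≈0 : f (- r) R.≈ 0#
      f[-r]≈0 = R.trans (R.*-congʳ (R.trans (R.+-congˡ (R.-‿cong a≈-ρ)) (R.-‿inverseʳ (- r))))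
          (R.zeroˡ _)

  -- Case distinction and return to the given list

  open Membership ℂ-setoid using (_∈_)

  ∈⇒≤ : ∀ {r d} τ → All (_≤ d) τ → ofReal r ∈ map ofReal τ → r ≤ d
  ∈⇒≤ (_ ∷ _) (x≤d ∷ _) (here r≈x) = Order.≤-respˡ-≈ (R.sym (re≈ r≈x)) x≤d
  ∈⇒≤ (_ ∷ τ) (_ ∷ τ≤d) (there r∈τ) = ∈⇒≤ τ τ≤d r∈τ

  ∣x∣≤ρ : ∀ σ → All (λ x → ∣ ofReal x ∣ ≤ ρ (map ofReal σ)) σ
  ∣x∣≤ρ σ = All.map⁻ (All.map⁻ (Extrema.xs≤max totalOrder 0# (map ∣_∣ (map ofReal σ))))

  realization-or-unstructured : ∀ {σ a b c d} → 0# < ρ (map ofReal σ) →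
    σ ↭ a ∷ b ∷ c ∷ d ∷ [] → a ≤ b → b ≤ c → c ≤ d → 0# ≤ d + a + (c + b) →
    IrreduciblyRealizableBy 4 (a ∷ b ∷ c ∷ d ∷ []) ⊎
    (¬ SpectrallySimple (map ofReal σ) × ¬ FrobeniusStructure (map ofReal σ))
  realization-or-unstructured {σ} {a} {b} {c} {d} 0<ρ σ↭ a≤b b≤c c≤d 0≤sum =
    decide (c<d? ×-dec 0<d+a?) (c<d? ×-dec (d + a Order.≟ 0# ×-dec b + c Order.≟ 0#))
    where
    <-dec : ∀ x y → Dec (x < y)
    <-dec x y = [ (λ y≤x → no λ x<y → <-≰ x<y y≤x) , yes ]′ (≤-or-> y x)

    c<d? = <-dec c d
    0<d+a? = <-dec 0# (d + a)

    bounds : All (λ x → ∣ ofReal x ∣ ≤ ρ (map ofReal σ)) (a ∷ b ∷ c ∷ d ∷ [])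
    bounds = ↭.All-resp-↭ σ↭ (∣x∣≤ρ σ)

    intervals : All (λ x → - ρ (map ofReal σ) ≤ x × x ≤ ρ (map ofReal σ)) (a ∷ b ∷ c ∷ d ∷ [])
    intervals = All.map (λ {x} ∣x∣≤ρ →
        0≤y-x⇒x≤y (0≤-resp (solve 2 (λ r x → r :- :- x := x :- :- r) R.refl _ x)
          (x≤y⇒0≤y-x (Order.trans (-x≤∣x∣ x) ∣x∣≤ρ))) ,
        Order.trans (x≤∣x∣ x) ∣x∣≤ρ) bounds

    d≤ρ : d ≤ ρ (map ofReal σ)
    d≤ρ = proj₂ (All.lookup intervals (there (there (there (here ≡.refl)))))

    σ≤d : All (_≤ d) σ
    σ≤d = ↭.All-resp-↭ (↭.↭-sym σ↭)
      (Order.trans a≤b (Order.trans b≤c c≤d) ∷ Order.trans b≤c c≤d ∷ c≤d ∷ Order.refl ∷ [])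

    simple⇒ : SpectrallySimple (map ofReal σ) → c < d × 0# < d + a
    simple⇒ (mult , only) = simple⇒dominant a≤b b≤c c≤d 0<ρ d≤ρ (All.head bounds)
      (≡.trans (≡.sym (multiplicity-↭ _ (↭.map⁺ ofReal σ↭))) mult)
      (All.head (↭.All-resp-↭ σ↭ (All.map⁻ only)))

    decide : Dec (c < d × 0# < d + a) → Dec (c < d × BalancedPairs a b c d) →
      IrreduciblyRealizableBy 4 (a ∷ b ∷ c ∷ d ∷ []) ⊎
      (¬ SpectrallySimple (map ofReal σ) × ¬ FrobeniusStructure (map ofReal σ))
    decide (yes (c<d , 0<d+a)) _ = inj₁ (dominant⇒realization a≤b b≤c c<d 0<d+a 0≤sum)
    -- Both pair sums vanish, so the Klein entry q is 0 and its condition holds with equality.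
    decide (no _) (yes (c<d , d+a≈0 , b+c≈0)) = inj₁ (klein-sorted a≤b b≤c c<d 0≤sum
      (Order.reflexive (R.sym (begin
        d + a - (c + b)   ≈⟨ R.+-cong d+a≈0 (R.-‿cong (R.trans (R.+-comm c b) b+c≈0)) ⟩
        0# - 0#           ≈⟨ R.-‿inverseʳ 0# ⟩
        0#                ∎))))
      where open SetoidReasoning R.setoid
    decide (no ¬dominant) (no ¬balanced) = inj₂ (¬dominant ∘ simple⇒ , λ F → ¬balanced
      (frobenius⇒balanced 0<ρ σ↭ intervals
        (Order.antisym d≤ρ (∈⇒≤ σ σ≤d (FrobeniusStructure.containsρ F))) c≤d ¬dominant F))

  -- Matching on the length equation is possible because `n` is a variable here; instantiating it
  -- with 4 afterwards gives a matrix of concrete size.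
  realizableBy : ∀ {n} σ → length (map ofReal σ) ≡ n → Realizable (map ofReal σ) →
    ∃ λ (A : Matrix ℝ n) → NonNegative A × HasSpectrum A (map ofReal σ)
  realizableBy _ ≡.refl realizable = realizable

  irreduciblyRealizable : ∀ {n σ τ} → length (map ofReal σ) ≡ n → σ ↭ τ →
    IrreduciblyRealizableBy n τ → IrreduciblyRealizable (map ofReal σ)
  irreduciblyRealizable ≡.refl σ↭τ (B , 0≤B , irreducible , χ≈) =
    B , 0≤B , irreducible , λ t → C.trans (χ≈ t) (C.sym (polynomialWithRoots-↭ σ↭τ t))

theorem20 : (𝓡 : Reals) → let open Spectra 𝓡 in
    (σ : List ℝ) → length σ ≡ 4 → 0# < ρ (map ofReal σ) →
    Realizable (map ofReal σ) →
    IrreduciblyRealizable (map ofReal σ) ⊎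
    (¬ SpectrallySimple (map ofReal σ) × ¬ FrobeniusStructure (map ofReal σ))
theorem20 𝓡 σ ∣σ∣≡4 0<ρ realizable =
  fromSorted (sort σ) (≡.trans (↭.↭-length (sort-↭ σ)) ∣σ∣≡4) (↭.↭-sym (sort-↭ σ)) (sort-↗ σ)
  where
  open Spectra 𝓡
  open RealSpectra 𝓡
  open Sort decTotalOrder using (sort; sort-↭; sort-↗)
  open Sorted totalOrder using (Sorted)

  -- The sorted list is generalised to a variable so that its length and its ordering can be
  -- matched, exposing the four entries.
  fromSorted : ∀ τ → length τ ≡ 4 → σ ↭ τ → Sorted τ →
    IrreduciblyRealizable (map ofReal σ) ⊎
    (¬ SpectrallySimple (map ofReal σ) × ¬ FrobeniusStructure (map ofReal σ))
  fromSorted (a ∷ b ∷ c ∷ d ∷ []) ≡.refl σ↭τ (a≤b ∷ b≤c ∷ c≤d ∷ [-]) =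
    ⊎.map₁ (irreduciblyRealizable ∣map∣≡4 σ↭τ)
      (realization-or-unstructured 0<ρ σ↭τ a≤b b≤c c≤d
        (let A , 0≤A , χ≈ = realizableBy σ ∣map∣≡4 realizable in
         spectrum-nonNegativeSum A 0≤A λ t → C.trans (χ≈ t) (polynomialWithRoots-↭ σ↭τ t)))
    where
    ∣map∣≡4 : length (map ofReal σ) ≡ 4
    ∣map∣≡4 = ≡.trans (length-map ofReal σ) ∣σ∣≡4
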